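{- Let $n>1$ be finite and let $\mathcal L_n$ be the logic corresponding to $\mathsf D_n$ or to $\mathsf G_n$. Then $\mathcal L_n$ has the omitting types theorem. In fact, if $T$ is a countable consistent $\mathcal L_n$ theory, then any family of fewer than $\mathrm{cov}K$ many non-principal types of $T$ can be omitted in a model of $T$ (of type $\mathsf D_n$, respectively $\mathsf G_n$) with countable base.
   Context: $\mathrm{cov}K$ is the least cardinal $\kappa$ such that the real line can be covered by $\kappa$ nowhere dense sets. $\mathsf D_n$ is the class of relativized set algebras with unit a set $V\subseteq{}^nM$ such that $s\in V$ implies $s\circ[i|j]\in V$ for all $i,j<n$ ($[i|j]$ sends $i$ to $j$ and fixes everything else); $\mathsf G_n$ is the class of those with unit $V$ such that $s\in V$ implies $s\circ\tau\in V$ for all $\tau:n\to n$. In such algebras $c_iX=\{s\in V:\exists t\in X,\ t_j=s_j\ \forall j\ne i\}$, $d_{ij}=\{s\in V:s_i=s_j\}$ (and for $\mathsf G_n$ also $s_\tau X=\{s\in V:s\circ\tau\in X\}$). The corresponding logic $\mathcal L_n$: formulas are built from $n$-ary relation symbols $R(x_0,\dots,x_{n-1})$ (for $\mathsf G_n$ also $R(x_{\tau(0)},\dots,x_{\tau(n-1)})$, $\tau:n\to n$) and equalities $x_i=x_j$ ($i,j<n$) by Boolean connectives and quantifiers $\exists x_i$, $i<n$. A model consists of a base $M$, a set $V\subseteq{}^nM$ that is a unit of the kind required for $\mathsf D_n$ (respectively $\mathsf G_n$) with $M=\bigcup_{s\in V}\mathrm{rng}(s)$, and an interpretation of each relation symbol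 as a subset of $V$. Satisfaction is defined only for $s\in V$ as usual, with quantifiers relativized to $V$: $s$ satisfies $\exists x_i\phi$ iff some $t\in V$ with $t_j=s_j$ for $j\ne i$ satisfies $\phi$; and $s$ satisfies $R(x_{\tau(0)},\dots,x_{\tau(n-1)})$ iff $s\circ\tau$ is in the interpretation of $R$. It is a model of $T$ if every $s\in V$ satisfies every formula of $T$. $T\models\phi$ means every model of $T$ has all $s\in V$ satisfying $\phi$; a formula $\psi$ is consistent with $T$ if not $T\models\neg\psi$. A type $\Gamma$ (set of formulas) is non-principal if there is no $\psi$ consistent with $T$ with $T\models\psi\to\gamma$ for all $\gamma\in\Gamma$. It is omitted in a model if no $s\in V$ satisfies all of $\Gamma$. $\mathcal L_n$ has the omitting types theorem if, for countable consistent $T$, any countable family of non-principal types can be omitted in a model of $T$. -}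

module Defs where

open import Level using (0ℓ)
open import Data.Nat.Base using (ℕ)
open import Data.Fin.Base using (Fin)
open import Data.Vec.Base using (Vec; lookup; map; allFin; _[_]≔_)
open import Data.Rational.Base using (ℚ; _<_)
open import Data.Product using (_×_; Σ; ∃; ∃-syntax)
open import Data.Sum.Base using (_⊎_)
open import Function.Bundles using (_↣_; _⇔_)
open import Relation.Binary.Definitions using (_Respects_)
open import Relation.Binary.PropositionalEquality using (_≡_; _≢_)
open import Relation.Nullary.Negation.Core using (¬_)
open import Relation.Unary using (Pred; _∈_; _∉_; _⊆_)

------------------------------------------------------------------------
-- Cardinality

Countable : Set → Set
Countable A = A ↣ ℕ

_≼_ : Set → Set → Set
I ≼ J = I ↣ J

_≺_ : Set → Set → Set
I ≺ J = (I ≼ J) × ¬ (J ≼ I)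

infix 4 _≼_ _≺_

------------------------------------------------------------------------
-- The real line (two-sided Dedekind cuts) with its order topology

record ℝ : Set₁ where
  field
    -- L p means p < x and U q means x < q.
    L U         : Pred ℚ 0ℓ
    L-inhabited : ∃[ p ] L p
    U-inhabited : ∃[ q ] U q
    L-rounded   : ∀ p → L p ⇔ (∃[ p′ ] p < p′ × L p′)
    U-rounded   : ∀ q → U q ⇔ (∃[ q′ ] q′ < q × U q′)
    disjoint    : ∀ q → ¬ (L q × U q)
    located     : ∀ p q → p < q → L p ⊎ U q

_≃_ : ℝ → ℝ → Set
x ≃ y = ∀ q → (ℝ.L x q ⇔ ℝ.L y q) × (ℝ.U x q ⇔ ℝ.U y q)

infix 4 _≃_

-- The open interval (p , q) with rational endpoints; these intervals form a
-- base of the topology.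
Interval : ℚ → ℚ → Pred ℝ 0ℓ
Interval p q x = ℝ.L x p × ℝ.U x q

Closure : Pred ℝ 0ℓ → ℝ → Set₁
Closure N x = ∀ p q → x ∈ Interval p q → ∃[ y ] y ∈ Interval p q × y ∈ N

Interior : (ℝ → Set₁) → ℝ → Set₁
Interior A x =
  ∃[ p ] ∃[ q ] x ∈ Interval p q × (∀ y → y ∈ Interval p q → A y)

NowhereDense : Pred ℝ 0ℓ → Set₁
NowhereDense N = ∀ x → ¬ Interior (Closure N) x

-- A subset of the line is a predicate on cuts that respects equality of reals.
CoversLine : Set → Set₁
CoversLine J =
  Σ (J → Pred ℝ 0ℓ) λ N →
    (∀ j → (N j) Respects _≃_) ×
    (∀ j → NowhereDense (N j)) ×
    (∀ x → ∃[ j ] x ∈ N j)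

-- κ has cardinality cov K.
IsCovK : Set → Set₁
IsCovK κ = CoversLine κ × (∀ J → CoversLine J → κ ≼ J)

------------------------------------------------------------------------
-- Units

data Kind : Set where
  𝖣 𝖦 : Kind

-- Sequences s ∈ ⁿM and transformations τ : n → n are both vectors, so that
-- equality of either is propositional; s ⊙ τ is the composite s ∘ τ.
_⊙_ : ∀ {M : Set} {n} → Vec M n → Vec (Fin n) n → Vec M n
s ⊙ τ = map (lookup s) τ

[_∣_] : ∀ {n} → Fin n → Fin n → Vec (Fin n) n
[ i ∣ j ] = allFin _ [ i ]≔ j

IsUnit : Kind → ∀ {M : Set} {n} → Pred (Vec M n) 0ℓ → Set
IsUnit 𝖣 V = ∀ s → s ∈ V → ∀ i j → (s ⊙ [ i ∣ j ]) ∈ V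
IsUnit 𝖦 V = ∀ s → s ∈ V → ∀ τ → (s ⊙ τ) ∈ V

------------------------------------------------------------------------
-- Syntax and semantics of 𝓛ₙ over a set S of n-ary relation symbols

data Formula (n : ℕ) (S : Set) : Kind → Set where
  -- R(x₀,…,xₙ₋₁)
  rel  : ∀ {k} → S → Formula n S k
  -- R(x_τ(0),…,x_τ(n-1))
  relₛ : S → Vec (Fin n) n → Formula n S 𝖦
  _≐_  : ∀ {k} → Fin n → Fin n → Formula n S k
  ∼_   : ∀ {k} → Formula n S k → Formula n S k
  _∧_  : ∀ {k} → Formula n S k → Formula n S k → Formula n S k
  ∃x   : ∀ {k} → Fin n → Formula n S k → Formula n S k

infix  8 _≐_
infix  7 ∼_
infixr 6 _∧_
infixr 5 _⇒_

_⇒_ : ∀ {n S k} → Formula n S k → Formula n S k → Formula n S k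
φ ⇒ ψ = ∼ (φ ∧ ∼ ψ)

record Model (n : ℕ) (S : Set) (k : Kind) : Set₁ where
  field
    Base     : Set
    -- Structures are nonempty; otherwise the empty unit would be a model of
    -- every theory and would omit every type.
    nonempty : Base
    V        : Pred (Vec Base n) 0ℓ
    isUnit   : IsUnit k V
    covered  : ∀ a → ∃[ s ] s ∈ V × (∃[ i ] lookup s i ≡ a)
    ⟦_⟧      : S → Pred (Vec Base n) 0ℓ
    ⟦⟧⊆V     : ∀ R → ⟦ R ⟧ ⊆ V

module _ {n : ℕ} {S : Set} {k : Kind} where

  -- Only meaningful for s ∈ V; every use below is restricted to such s.
  Sat : (𝔐 : Model n S k) → Vec (Model.Base 𝔐) n → Formula n S k → Set
  Sat 𝔐 s (rel R)    = s ∈ Model.⟦_⟧ 𝔐 R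
  Sat 𝔐 s (relₛ R τ) = (s ⊙ τ) ∈ Model.⟦_⟧ 𝔐 R
  Sat 𝔐 s (i ≐ j)    = lookup s i ≡ lookup s j
  Sat 𝔐 s (∼ φ)      = ¬ Sat 𝔐 s φ
  Sat 𝔐 s (φ ∧ ψ)    = Sat 𝔐 s φ × Sat 𝔐 s ψ
  Sat 𝔐 s (∃x i φ)   =
    ∃[ t ] t ∈ Model.V 𝔐 × (∀ j → j ≢ i → lookup t j ≡ lookup s j) × Sat 𝔐 t φ

  Valid : Model n S k → Formula n S k → Set
  Valid 𝔐 φ = ∀ s → s ∈ Model.V 𝔐 → Sat 𝔐 s φ

  Theory : Set₁
  Theory = Pred (Formula n S k) 0ℓ

  _IsModelOf_ : Model n S k → Theory → Set
  𝔐 IsModelOf T = ∀ φ → φ ∈ T → Valid 𝔐 φ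

  _⊨_ : Theory → Formula n S k → Set₁
  T ⊨ φ = ∀ 𝔐 → 𝔐 IsModelOf T → Valid 𝔐 φ

  Consistent : Theory → Set₁
  Consistent T = ∃[ 𝔐 ] 𝔐 IsModelOf T

  _ConsistentWith_ : Formula n S k → Theory → Set₁
  ψ ConsistentWith T = ¬ (T ⊨ (∼ ψ))

  NonPrincipal : Theory → Pred (Formula n S k) 0ℓ → Set₁
  NonPrincipal T Γ =
    ¬ (∃[ ψ ] ψ ConsistentWith T × (∀ γ → γ ∈ Γ → T ⊨ (ψ ⇒ γ)))

  _Omits_ : Model n S k → Pred (Formula n S k) 0ℓ → Set
  𝔐 Omits Γ = ¬ (∃[ s ] s ∈ Model.V 𝔐 × (∀ γ → γ ∈ Γ → Sat 𝔐 s γ))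

-- A countable theory is a theory in a countable signature.
OmittingTypesTheorem : ℕ → Kind → Set₁
OmittingTypesTheorem n k =
  (S : Set) → Countable S →
  (T : Pred (Formula n S k) 0ℓ) → Consistent T →
  (I : Set) → Countable I →
  (Γ : I → Pred (Formula n S k) 0ℓ) → (∀ i → NonPrincipal T (Γ i)) →
  ∃[ 𝔐 ] 𝔐 IsModelOf T × (∀ i → 𝔐 Omits Γ i)

module Submission where

-- The model is built by finite conditions. A condition is a finite list of
-- assertions that a tuple of constants lies in the unit and satisfies a formula,
-- and it is admissible if some model of T realizes it. A descending chain of
-- conditions that decides all formulas, names witnesses, and asserts, for every
-- type Γ and every tuple s, some ∼ γ with γ ∈ Γ at s, has as its limit a
-- model with countable base in which truth is assertion (forced⇒true,
-- true⇒forced). It remains to see that omitting Γ at s can be achieved by extending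
-- any condition, and that a chain can meet all these demands.
--
-- For the first point, what a condition says about one of its tuples has to be
-- expressed by one formula in n variables; nonprincipality then yields γ. Here
-- relativization is decisive. A new tuple is only ever attached to a present one,
-- by changing one coordinate to a fresh constant or to another entry of the
-- tuple or, for 𝖦, by interchanging two coordinates. Constants need to
-- denote different elements only if they occur in a common tuple. So conditions are trees,
-- every edge is expressed by a formula in both directions, and the whole
-- tree can be folded into a formula at any of its tuples (describe). Units closed under
-- these steps are closed under all transformations that 𝖣 or 𝖦 asks for
-- (unit-from-generators).
--
-- For the second point, let I index the types. There are I × ω demands, while
-- the hypothesis says that I nowhere dense sets do not cover the line. The way from one
-- to the other is through guessing. Reading a function off each
-- real turns the hypothesis into this: for every family of functions fᵢ
-- on ℕ some function meets each fᵢ at least once (≺-covK⇒Guessable). Guessing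
-- separately on infinitely many disjoint domains gives infinitely many agreements
-- (guess-infinitely-often). In the manner of Bartoszyński's analysis of cov K
-- this improves to bounds that infinitely often are not outrun (outgrow),
-- and to agreement inside prescribed infinite sets (guess-within). Now code a poset
-- by ℕ, and guess at time t the finite part of a strategy that concerns
-- positions below the t-th bound. A chain that follows its guesses as long as it stays
-- within the bounds meets I × ω dense sets (generic). A countable family is
-- guessable by diagonalization, so one construction serves both statements.
--
-- Excluded middle decides all types, not only propositions, and so
-- selects elements; all choices made below are of this kind.

open import Defs
open import Level using (0ℓ; Lift; lift; lower) renaming (suc to lsuc)
open import Axiom.ExcludedMiddle using (ExcludedMiddle)
open import Data.Bool.Base using (Bool; true)
open import Data.Nat.Base
  using (ℕ; zero; suc; _+_; _*_; _⊔_; _<_; _≤_; z≤n; s≤s)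
open import Data.Nat.Properties
open import Data.Fin.Base using (Fin; zero; suc; toℕ; fromℕ<)
open import Data.Fin.Properties
  using (toℕ-injective; pigeonhole) renaming (_≟_ to _≟ᶠ_)
open import Data.Fin.Permutation.Components using (transpose; transpose-inverse)
open import Data.Integer.Base as ℤ using (ℤ; +_; -[1+_])
open import Data.Rational.Base as ℚ using (ℚ; mkℚ; 1ℚ; *<*)
import Data.Rational.Properties as ℚ
open import Data.Product using (_×_; _,_; proj₁; proj₂; Σ; ∃-syntax)
open import Data.Sum.Base using (_⊎_; inj₁; inj₂)
open import Data.Maybe.Base using (Maybe; just; nothing; maybe′)
open import Data.List.Base as List using (List; []; _∷_; length)
open import Data.List.Relation.Unary.Any using (here; there; index)
open import Data.List.Relation.Unary.Any.Properties using (lookup-index)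
open import Data.List.Membership.Propositional
  using () renaming (_∈_ to _∈ˡ_; _∉_ to _∉ˡ_)
open import Data.List.Membership.Propositional.Properties
  using (∈-tabulate⁺; ∈-tabulate⁻) renaming (∈-allFin to ∈ˡ-allFin)
open import Data.Vec.Base as Vec
  using (Vec; _∷_; lookup; map; allFin; tabulate; _[_]≔_)
open import Data.Vec.Properties
  using ( toList-injective; cast-is-id; ≡-dec; lookup-map; lookup-allFin
        ; lookup∘tabulate; tabulate∘lookup; tabulate-cong; map-cong; map-∘
        ; map-lookup-allFin; lookup∘update; lookup∘update′ )
open import Function.Base using (_∘_; id)
open import Function.Bundles using (mk↣; Injection; mk⇔; Equivalence)
open import Relation.Binary.Definitions using (tri<; tri≈; tri>)
open import Relation.Binary.PropositionalEquality
open import Relation.Nullary using (Dec; yes; no; ¬_; contradiction; does)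
open import Relation.Nullary.Decidable using (map′; dec-true)
open import Relation.Unary using (Pred; _∈_; _∉_)

-- Countable types

code : ∀ {A} → Countable A → A → ℕ
code = Injection.to

code-injective : ∀ {A} (c : Countable A) {x y} → code c x ≡ code c y → x ≡ y
code-injective = Injection.injective

opaque
  pair : ℕ → ℕ → ℕ
  pair a b = (a + b) * (a + b) + a

  -- The pair (a , b) lies in the block [s², (s+1)²) with s = a + b, at offset a;
  -- blocks with different s are disjoint.
  pair-block : ∀ a b s → a + b < s → pair a b < s * s
  pair-block a b s a+b<s = begin-strict
    (a + b) * (a + b) + a               ≤⟨ +-monoʳ-≤ ((a + b) * (a + b)) (m≤m+n a b) ⟩
    (a + b) * (a + b) + (a + b)         ≡⟨ +-comm ((a + b) * (a + b)) (a + b) ⟩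
    suc (a + b) * (a + b)               <⟨ *-monoʳ-< (suc (a + b)) (n<1+n (a + b)) ⟩
    suc (a + b) * suc (a + b)           ≤⟨ *-mono-≤ a+b<s a+b<s ⟩
    s * s                               ∎
    where open ≤-Reasoning

  pair-sum : ∀ a b a′ b′ → pair a b ≡ pair a′ b′ → a + b ≡ a′ + b′
  pair-sum a b a′ b′ eq with <-cmp (a + b) (a′ + b′)
  ... | tri≈ _ same _ = same
  ... | tri< lt _ _ = contradiction
    (≤-trans (pair-block a b _ lt) (m≤m+n _ a′)) (<-irrefl eq)
  ... | tri> _ _ gt = contradiction
    (≤-trans (pair-block a′ b′ _ gt) (m≤m+n _ a)) (<-irrefl (sym eq))

  pair-injective : ∀ a b a′ b′ → pair a b ≡ pair a′ b′ → a ≡ a′ × b ≡ b′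
  pair-injective a b a′ b′ eq with pair-sum a b a′ b′ eq
  ... | same with +-cancelˡ-≡ ((a′ + b′) * (a′ + b′)) a a′
                    (trans (cong (λ s → s * s + a) (sym same)) eq)
  ... | refl = refl , +-cancelˡ-≡ a b b′ same

  pair-≥ˡ : ∀ a b → a ≤ pair a b
  pair-≥ˡ a b = m≤n+m a ((a + b) * (a + b))

ℕ-countable : Countable ℕ
ℕ-countable = mk↣ id

Fin-countable : ∀ {n} → Countable (Fin n)
Fin-countable = mk↣ toℕ-injective

infixr 3 _×-countable_
infixr 2 _⊎-countable_

opaque
  _×-countable_ : ∀ {A B} → Countable A → Countable B → Countable (A × B)
  _×-countable_ {A} {B} α β = mk↣ {to = to} inj
    where
    to : A × B → ℕ
    to (x , y) = pair (code α x) (code β y)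
    inj : ∀ {u v} → to u ≡ to v → u ≡ v
    inj {x , y} {x′ , y′} eq with pair-injective _ (code β y) _ (code β y′) eq
    ... | p , q = cong₂ _,_ (code-injective α p) (code-injective β q)

  code-×-≥ : ∀ {A B} (α : Countable A) (β : Countable B) x y →
    code α x ≤ code (α ×-countable β) (x , y)
  code-×-≥ α β x y = pair-≥ˡ (code α x) (code β y)

  _⊎-countable_ : ∀ {A B} → Countable A → Countable B → Countable (A ⊎ B)
  _⊎-countable_ {A} {B} α β = mk↣ {to = to} inj
    where
    to : A ⊎ B → ℕ
    to (inj₁ x) = pair 0 (code α x)
    to (inj₂ y) = pair 1 (code β y)
    inj : ∀ {u v} → to u ≡ to v → u ≡ v
    inj {inj₁ x} {inj₁ x′} eq =
      cong inj₁ (code-injective α (proj₂ (pair-injective 0 _ 0 _ eq)))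
    inj {inj₂ y} {inj₂ y′} eq =
      cong inj₂ (code-injective β (proj₂ (pair-injective 1 _ 1 _ eq)))
    inj {inj₁ x} {inj₂ y} eq with () ← proj₁ (pair-injective 0 (code α x) 1 (code β y) eq)
    inj {inj₂ y} {inj₁ x} eq with () ← proj₁ (pair-injective 1 (code β y) 0 (code α x) eq)

opaque
  List-countable : ∀ {A} → Countable A → Countable (List A)
  List-countable {A} α = mk↣ {to = to} (inj _ _)
    where
    to : List A → ℕ
    to []       = 0
    to (x ∷ xs) = suc (pair (code α x) (to xs))
    inj : ∀ xs ys → to xs ≡ to ys → xs ≡ ys
    inj []       []       _  = refl
    inj (x ∷ xs) (y ∷ ys) eq with pair-injective _ (to xs) _ (to ys) (suc-injective eq)
    ... | p , q = cong₂ _∷_ (code-injective α p) (inj xs ys q)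

opaque
  Vec-countable : ∀ {A n} → Countable A → Countable (Vec A n)
  Vec-countable α = mk↣ λ {xs} {ys} eq →
    trans (sym (cast-is-id refl xs)) (toList-injective refl xs ys (code-injective (List-countable α) eq))

opaque
  ℚ-countable : Countable ℚ
  ℚ-countable = mk↣ {to = to} (inj _ _)
    where
    ℤ-countable : Countable ℤ
    ℤ-countable = mk↣ {to = λ i → code (ℕ-countable ⊎-countable ℕ-countable) (split i)}
      λ {i} {j} eq → split-injective i j (code-injective (ℕ-countable ⊎-countable ℕ-countable) eq)
      where
      split : ℤ → ℕ ⊎ ℕ
      split (+ n)    = inj₁ n
      split -[1+ n ] = inj₂ n
      split-injective : ∀ i j → split i ≡ split j → i ≡ j
      split-injective (+ _)    (+ _)    refl = refl
      split-injective -[1+ _ ] -[1+ _ ] refl = refl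
    to : ℚ → ℕ
    to (mkℚ n d _) = code (ℤ-countable ×-countable ℕ-countable) (n , d)
    inj : ∀ p q → to p ≡ to q → p ≡ q
    inj (mkℚ n d _) (mkℚ n′ d′ _) eq
      with refl ← code-injective (ℤ-countable ×-countable ℕ-countable) {n , d} {n′ , d′} eq = refl

-- One layer of the syntax, with subformulas replaced by elements of X.
Layer : ℕ → Set → Set → Set
Layer n S X =
  (S ⊎ S × Vec (Fin n) n ⊎ Fin n × Fin n) ⊎ (X ⊎ X × X ⊎ Fin n × X)

Formula-countable : ∀ {n S k} → Countable S → Countable (Formula n S k)
Formula-countable {n} {S} {k} ς = mk↣ {to = to} (inj _ _)
  where
  layer : Countable (Layer n S ℕ)
  layer =
    (ς ⊎-countable ς ×-countable Vec-countable Fin-countable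
       ⊎-countable Fin-countable ×-countable Fin-countable)
    ⊎-countable
    (ℕ-countable ⊎-countable ℕ-countable ×-countable ℕ-countable
       ⊎-countable Fin-countable ×-countable ℕ-countable)
  to : Formula n S k → ℕ
  outer : Formula n S k → Layer n S ℕ
  outer (rel R)    = inj₁ (inj₁ R)
  outer (relₛ R τ) = inj₁ (inj₂ (inj₁ (R , τ)))
  outer (i ≐ j)    = inj₁ (inj₂ (inj₂ (i , j)))
  outer (∼ φ)      = inj₂ (inj₁ (to φ))
  outer (φ ∧ ψ)    = inj₂ (inj₂ (inj₁ (to φ , to ψ)))
  outer (∃x i φ)   = inj₂ (inj₂ (inj₂ (i , to φ)))
  to φ = code layer (outer φ)
  inj  : ∀ φ ψ → to φ ≡ to ψ → φ ≡ ψ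
  inj′ : ∀ φ ψ → outer φ ≡ outer ψ → φ ≡ ψ
  inj φ ψ eq = inj′ φ ψ (code-injective layer eq)
  inj′ (rel R)    (rel R′)     refl = refl
  inj′ (relₛ R τ) (relₛ R′ τ′) refl = refl
  inj′ (i ≐ j)    (i′ ≐ j′)    refl = refl
  inj′ (∼ φ)      (∼ ψ)        eq   = cong ∼_ (inj φ ψ (un eq))
    where
    un : ∀ {a b : ℕ} → _≡_ {A = Layer n S ℕ} (inj₂ (inj₁ a)) (inj₂ (inj₁ b)) → a ≡ b
    un refl = refl
  inj′ (φ ∧ φ′)   (ψ ∧ ψ′)     eq   = cong₂ _∧_ (inj φ ψ (proj₁ (un eq))) (inj φ′ ψ′ (proj₂ (un eq)))
    where
    un : ∀ {a b c d : ℕ} →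
      _≡_ {A = Layer n S ℕ} (inj₂ (inj₂ (inj₁ (a , b)))) (inj₂ (inj₂ (inj₁ (c , d)))) →
      a ≡ c × b ≡ d
    un refl = refl , refl
  inj′ (∃x i φ)   (∃x j ψ)     eq   = cong₂ ∃x (proj₁ (un eq)) (inj φ ψ (proj₂ (un eq)))
    where
    un : ∀ {i j : Fin n} {b d : ℕ} →
      _≡_ {A = Layer n S ℕ} (inj₂ (inj₂ (inj₂ (i , b)))) (inj₂ (inj₂ (inj₂ (j , d)))) →
      i ≡ j × b ≡ d
    un refl = refl , refl

-- Choice and guessing

total : (ℕ → ℕ) → ℕ → ℕ
total f zero    = f zero
total f (suc m) = total f m + f (suc m)

≤-total-sum : ∀ f {k m} → k ≤ m → f k ≤ total f m
≤-total-sum f {k} {zero}  z≤n = ≤-refl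
≤-total-sum f {k} {suc m} k≤1+m with m≤n⇒m<n∨m≡n k≤1+m
... | inj₁ (s≤s k≤m) = ≤-trans (≤-total-sum f k≤m) (m≤m+n _ _)
... | inj₂ refl      = m≤n+m _ _

total-mono : ∀ f {k m} → k ≤ m → total f k ≤ total f m
total-mono f {k} {zero}  z≤n = ≤-refl
total-mono f {k} {suc m} k≤1+m with m≤n⇒m<n∨m≡n k≤1+m
... | inj₁ (s≤s k≤m) = ≤-trans (total-mono f k≤m) (m≤m+n _ _)
... | inj₂ refl      = ≤-refl

-- What is used of the fact that J many nowhere dense sets do not cover the line.
Guessable : Set → Set
Guessable J = ∀ (f : J → ℕ → ℕ) → Σ (ℕ → ℕ) λ g → ∀ j → ∃[ k ] g k ≡ f j k

module Choice (em : ExcludedMiddle (lsuc 0ℓ)) where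

  dec : (A : Set) → Dec A
  dec A = map′ lower lift (em {Lift (lsuc 0ℓ) A})

  byContradiction : {A : Set} → ¬ ¬ A → A
  byContradiction {A} ¬¬a with dec A
  ... | yes a = a
  ... | no ¬a = contradiction ¬a ¬¬a

  -- A right inverse of f on its range. It depends on y alone, so it chooses
  -- one preimage for each point of the range.
  preimage : ∀ {A B : Set} → (A → B) → A → B → A
  preimage {A} f default y with dec (Σ A λ x → f x ≡ y)
  ... | yes (x , _) = x
  ... | no _        = default

  preimage-correct : ∀ {A B : Set} (f : A → B) d x → f (preimage f d (f x)) ≡ f x
  preimage-correct {A} f d x with dec (Σ A λ x′ → f x′ ≡ f x)
  ... | yes (_ , eq) = eq
  ... | no none      = contradiction (x , refl) none

  decode : ∀ {A} → Countable A → A → ℕ → A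
  decode c = preimage (code c)

  decode-code : ∀ {A} (c : Countable A) d x → decode c d (code c x) ≡ x
  decode-code c d x = code-injective c (preimage-correct (code c) d x)

  opaque
    -- With an injection of J into ℕ the diagonal function will do.
    Countable⇒Guessable : ∀ {J} → Countable J → Guessable J
    Countable⇒Guessable {J} c f = g , λ j → code c j , hit j
      where
      g : ℕ → ℕ
      g k with dec (Σ J λ j → code c j ≡ k)
      ... | yes (j , _) = f j k
      ... | no _        = 0
      hit : ∀ j → g (code c j) ≡ f j (code c j)
      hit j with dec (Σ J λ j′ → code c j′ ≡ code c j)
      ... | yes (j′ , eq) = cong (λ j″ → f j″ (code c j)) (code-injective c eq)
      ... | no none       = contradiction (j , refl) none

  opaque
    -- Argument 0 is set aside for the new function. The additional index will carry
    -- the countably many requirements that do not come from a type.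
    Maybe-guessable : ∀ {J} → Guessable J → Guessable (Maybe J)
    Maybe-guessable {J} guess f = g , hit
      where
      tail : Σ (ℕ → ℕ) λ g → ∀ j → ∃[ k ] g k ≡ f (just j) (suc k)
      tail = guess λ j k → f (just j) (suc k)
      g : ℕ → ℕ
      g zero    = f nothing zero
      g (suc k) = proj₁ tail k
      hit : ∀ j → ∃[ k ] g k ≡ f j k
      hit nothing  = zero , refl
      hit (just j) = suc (proj₁ (proj₂ tail j)) , proj₂ (proj₂ tail j)

  module Guessing {J : Set} (guess : Guessable J) where

    opaque
      -- Guessing row by row on ℕ × ℕ gives one agreement in each row, hence infinitely
      -- many. Countably many guessing functions, chosen independently of each other, are
      -- glued into one; this is the passage from J to J × ω.
      guess-infinitely-often : ∀ {B} → Countable B → B → (f : J → ℕ → B) →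
        Σ (ℕ → B) λ g → ∀ j N → ∃[ k ] N ≤ k × g k ≡ f j k
      guess-infinitely-often {B} β b₀ f = g , hit
        where
        ℕ² : Countable (ℕ × ℕ)
        ℕ² = ℕ-countable ×-countable ℕ-countable
        row : ∀ N → Σ (ℕ → ℕ) λ g →
          ∀ j → ∃[ k ] g k ≡ code β (f j (code ℕ² (N , k)))
        row N = guess λ j k → code β (f j (code ℕ² (N , k)))
        answer : ℕ × ℕ → B
        answer (N , k) = decode β b₀ (proj₁ (row N) k)
        g : ℕ → B
        g m = answer (decode ℕ² (0 , 0) m)
        hit : ∀ j N → ∃[ k ] N ≤ k × g k ≡ f j k
        hit j N with proj₂ (row N) j
        ... | k , eq =
          code ℕ² (N , k) , code-×-≥ ℕ-countable ℕ-countable N k , (begin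
          g (code ℕ² (N , k))                        ≡⟨ cong answer (decode-code ℕ² (0 , 0) (N , k)) ⟩
          decode β b₀ (proj₁ (row N) k)              ≡⟨ cong (decode β b₀) eq ⟩
          decode β b₀ (code β (f j (code ℕ² (N , k)))) ≡⟨ decode-code β b₀ _ ⟩
          f j (code ℕ² (N , k))                      ∎)
          where open ≡-Reasoning

    opaque
      -- Let g agree infinitely often with each h j ∘ h j, and let b (suc t) exceed all values
      -- of g up to b t. If g agrees with h j ∘ h j at r and b t ≤ r < b (suc t), then the
      -- step from b t or the following one is long enough for h j: either b (suc t) is at least
      -- h j (b t), or it is below h j r and the next bound exceeds g r = h j (h j r).
      outgrow : (h : J → ℕ → ℕ) → (∀ j {k m} → k ≤ m → h j k ≤ h j m) → (b₀ : ℕ) →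
        Σ (ℕ → ℕ) λ b → b 0 ≡ b₀ × (∀ t → t ≤ b t) × (∀ t → b t ≤ b (suc t)) ×
          (∀ j N → ∃[ t ] N ≤ t × h j (b t) ≤ b (suc t))
      outgrow h h-mono b₀ = b , refl , b-large , b-mono , fast
        where
        guesses : Σ (ℕ → ℕ) λ g → ∀ j N → ∃[ k ] N ≤ k × g k ≡ h j (h j k)
        guesses = guess-infinitely-often ℕ-countable 0 λ j k → h j (h j k)
        g : ℕ → ℕ
        g = proj₁ guesses
        b : ℕ → ℕ
        b zero    = b₀
        b (suc t) = suc (b t + total g (b t))
        b-step : ∀ t → b t < b (suc t)
        b-step t = s≤s (m≤m+n (b t) _)
        b-mono : ∀ t → b t ≤ b (suc t)
        b-mono t = <⇒≤ (b-step t)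
        b-large : ∀ t → t ≤ b t
        b-large zero    = z≤n
        b-large (suc t) = ≤-trans (s≤s (b-large t)) (b-step t)
        above : ∀ t → total g (b t) ≤ b (suc t)
        above t = ≤-trans (m≤n+m _ (b t)) (n≤1+n _)
        locate : ∀ {N r} → b N ≤ r → ∀ k → r < b (k + N) →
          ∃[ t ] N ≤ t × b t ≤ r × r < b (suc t)
        locate {N} lo zero    hi = contradiction lo (<⇒≱ hi)
        locate {N} {r} lo (suc k) hi with b (k + N) ≤? r
        ... | yes p = k + N , m≤n+m N k , p , hi
        ... | no ¬p = locate lo k (≰⇒> ¬p)
        fast : ∀ j N → ∃[ t ] N ≤ t × h j (b t) ≤ b (suc t)
        fast j N with proj₂ guesses j (b N)
        ... | r , bN≤r , eq
          with locate bN≤r (suc r) (≤-trans (s≤s (m≤m+n r N)) (b-large (suc r + N)))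
        ... | t , N≤t , bt≤r , r<bt′ with h j (b t) ≤? b (suc t)
        ... | yes p = t , N≤t , p
        ... | no ¬p = suc t , ≤-trans N≤t (n≤1+n t) , (begin
          h j (b (suc t))      ≤⟨ h-mono j (<⇒≤ (≰⇒> ¬p)) ⟩
          h j (h j (b t))      ≤⟨ h-mono j (h-mono j bt≤r) ⟩
          h j (h j r)          ≡⟨ sym eq ⟩
          g r                  ≤⟨ ≤-total-sum g (<⇒≤ r<bt′) ⟩
          total g (b (suc t))  ≤⟨ above (suc t) ⟩
          b (suc (suc t))      ∎)
          where open ≤-Reasoning

    opaque
      -- What is guessed at stage r is the list of the values of f j at r + 1
      -- elements of X j. At most r arguments of g have been committed before, so a correct guess
      -- offers an uncommitted one, which is then committed to the value offered. No argument
      -- is committed twice, so g is well defined.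
      guess-within : ∀ {B} → Countable B → B → (X : J → ℕ → Set) →
        (∀ j N → ∃[ t ] N ≤ t × X j t) → (f : J → ℕ → B) →
        Σ (ℕ → B) λ g → ∀ j N → ∃[ t ] N ≤ t × X j t × g t ≡ f j t
      guess-within {B} β b₀ X unbounded f = g , hit
        where
        member : J → ℕ → ℕ → ℕ
        member j r zero    = proj₁ (unbounded j r)
        member j r (suc a) = proj₁ (unbounded j (suc (member j r a)))

        member-∈ : ∀ j r a → X j (member j r a)
        member-∈ j r zero    = proj₂ (proj₂ (unbounded j r))
        member-∈ j r (suc a) = proj₂ (proj₂ (unbounded j (suc (member j r a))))

        member-step : ∀ j r a → member j r a < member j r (suc a)
        member-step j r a = proj₁ (proj₂ (unbounded j (suc (member j r a))))

        member-mono : ∀ j r {a c} → a < c → member j r a < member j r c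
        member-mono j r {a} {suc c} (s≤s a≤c) with m≤n⇒m<n∨m≡n a≤c
        ... | inj₁ a<c  = <-trans (member-mono j r a<c) (member-step j r c)
        ... | inj₂ refl = member-step j r c

        member-≥ : ∀ j r a → r ≤ member j r a
        member-≥ j r zero    = proj₁ (proj₂ (unbounded j r))
        member-≥ j r (suc a) = ≤-trans (member-≥ j r a) (<⇒≤ (member-step j r a))

        entry : J → (r : ℕ) → Fin (suc r) → ℕ × B
        entry j r a = member j r (toℕ a) , f j (member j r (toℕ a))

        guesses : Σ (ℕ → List (ℕ × B)) λ g →
          ∀ j N → ∃[ k ] N ≤ k × g k ≡ List.tabulate (entry j k)
        guesses = guess-infinitely-often (List-countable (ℕ-countable ×-countable β)) []
                    λ j r → List.tabulate (entry j r)

        offers : ℕ → List (ℕ × B)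
        offers = proj₁ guesses

        New : List ℕ → List (ℕ × B) → Set
        New us es = Σ (ℕ × B) λ e → e ∈ˡ es × proj₁ e ∉ˡ us

        pick : List ℕ → List (ℕ × B) → Maybe (ℕ × B)
        pick us es with dec (New us es)
        ... | yes (e , _) = just e
        ... | no _        = nothing

        pick-just : ∀ us es {e} → pick us es ≡ just e → e ∈ˡ es × proj₁ e ∉ˡ us
        pick-just us es eq with dec (New us es)
        pick-just us es refl | yes (e , ok) = ok

        pick-succeeds : ∀ us es → New us es → ∃[ e ] pick us es ≡ just e
        pick-succeeds us es new with dec (New us es)
        ... | yes (e , _) = e , refl
        ... | no none     = contradiction new none

        used   : ℕ → List ℕ
        choice : ℕ → Maybe (ℕ × B)
        choice r = pick (used r) (offers r)
        used zero    = []
        used (suc r) = maybe′ (λ e → proj₁ e ∷ used r) (used r) (choice r)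

        used-length : ∀ r → length (used r) ≤ r
        used-length zero = z≤n
        used-length (suc r) with choice r
        ... | just _  = s≤s (used-length r)
        ... | nothing = ≤-trans (used-length r) (n≤1+n r)

        used-step : ∀ r {t} → t ∈ˡ used r → t ∈ˡ used (suc r)
        used-step r t∈ with choice r
        ... | just _  = there t∈
        ... | nothing = t∈

        used-new : ∀ r {e} → choice r ≡ just e → proj₁ e ∈ˡ used (suc r)
        used-new r eq with choice r
        used-new r refl | just _ = here refl

        used-later : ∀ {r r′ e} → r < r′ → choice r ≡ just e → proj₁ e ∈ˡ used r′
        used-later {r} {suc r′} (s≤s r≤r′) eq with m≤n⇒m<n∨m≡n r≤r′
        ... | inj₁ r<r′ = used-step r′ (used-later r<r′ eq)
        ... | inj₂ refl = used-new r eq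

        -- An argument committed at one stage is in use at all later ones.
        choice-unique : ∀ {r r′ t b b′} →
          choice r ≡ just (t , b) → choice r′ ≡ just (t , b′) → b ≡ b′
        choice-unique {r} {r′} eq eq′ with <-cmp r r′
        ... | tri< lt _ _   = contradiction (used-later lt eq) (proj₂ (pick-just _ _ eq′))
        ... | tri> _ _ gt   = contradiction (used-later gt eq′) (proj₂ (pick-just _ _ eq))
        ... | tri≈ _ refl _ = ,-injectiveʳ-just (trans (sym eq) eq′)
          where
          ,-injectiveʳ-just : ∀ {t : ℕ} {b b′ : B} → just (t , b) ≡ just (t , b′) → b ≡ b′
          ,-injectiveʳ-just refl = refl

        Answer : ℕ → Set
        Answer t = Σ B λ b → ∃[ r ] choice r ≡ just (t , b)

        g : ℕ → B
        g t with dec (Answer t)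
        ... | yes (b , _) = b
        ... | no _        = b₀

        g-correct : ∀ {r t b} → choice r ≡ just (t , b) → g t ≡ b
        g-correct {t = t} eq with dec (Answer t)
        ... | yes (_ , _ , eq′) = choice-unique eq′ eq
        ... | no none           = contradiction (_ , _ , eq) none

        -- r + 1 different arguments cannot all be among the at most r used ones.
        row-new : ∀ j r → New (used r) (List.tabulate (entry j r))
        row-new j r = byContradiction λ none →
          let all : ∀ a → member j r (toℕ a) ∈ˡ used r
              all a = byContradiction λ new → none (entry j r a , ∈-tabulate⁺ {f = entry j r} a , new)
              a , c , a<c , same = pigeonhole (s≤s (used-length r)) (index ∘ all)
          in <-irrefl
               (trans (lookup-index (all a))
                 (trans (cong (List.lookup (used r)) same) (sym (lookup-index (all c)))))
               (member-mono j r a<c)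

        hit : ∀ j N → ∃[ t ] N ≤ t × X j t × g t ≡ f j t
        hit j N with proj₂ guesses j N
        ... | r , N≤r , eq
          with pick-succeeds (used r) (offers r)
                 (subst (New (used r)) (sym eq) (row-new j r))
        ... | e , picked
          with ∈-tabulate⁻ {f = entry j r}
                 (subst (e ∈ˡ_) eq (proj₁ (pick-just (used r) (offers r) picked)))
        ... | a , refl =
          member j r (toℕ a) , ≤-trans N≤r (member-≥ j r (toℕ a)) ,
          member-∈ j r (toℕ a) , g-correct picked

-- From the real line to guessing

-- Otherwise the lower cut, being closed downwards, would meet the upper one.
lower<upper : ∀ (x : ℝ) {l u} → ℝ.L x l → ℝ.U x u → l ℚ.< u
lower<upper x {l} {u} Ll Uu with ℚ.<-cmp l u
... | tri< l<u _ _  = l<u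
... | tri≈ _ refl _ = contradiction (Ll , Uu) (ℝ.disjoint x l)
... | tri> _ _ u<l  =
  contradiction (Equivalence.from (ℝ.L-rounded x u) (l , u<l , Ll) , Uu) (ℝ.disjoint x u)

fromℚ : ℚ → ℝ
fromℚ r = record
  { L = ℚ._< r
  ; U = r ℚ.<_
  ; L-inhabited = r ℚ.+ ℚ.- 1ℚ , subst (r ℚ.+ ℚ.- 1ℚ ℚ.<_) (ℚ.+-identityʳ r) (ℚ.+-monoʳ-< r (*<* ℤ.-<+))
  ; U-inhabited = r ℚ.+ 1ℚ , subst (ℚ._< r ℚ.+ 1ℚ) (ℚ.+-identityʳ r) (ℚ.+-monoʳ-< r (*<* (ℤ.+<+ (s≤s z≤n))))
  ; L-rounded = λ p → mk⇔ (λ p<r → let (m , p<m , m<r) = ℚ.<-dense p<r in m , p<m , m<r)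
                          (λ (m , p<m , m<r) → ℚ.<-trans p<m m<r)
  ; U-rounded = λ q → mk⇔ (λ r<q → let (m , r<m , m<q) = ℚ.<-dense r<q in m , m<q , r<m)
                          (λ (m , m<q , r<m) → ℚ.<-trans r<m m<q)
  ; disjoint = λ q (q<r , r<q) → ℚ.<-asym q<r r<q
  ; located = located
  }
  where
  located : ∀ p q → p ℚ.< q → p ℚ.< r ⊎ r ℚ.< q
  located p q p<q with ℚ.<-cmp p r
  ... | tri< p<r _ _  = inj₁ p<r
  ... | tri≈ _ refl _ = inj₂ p<q
  ... | tri> _ _ r<p  = inj₂ (ℚ.<-trans r<p p<q)

-- The points q = c₀ > c₁ > c₂ > … above p, cutting off infinitely many disjoint
-- open intervals (c_{m+1} , c_m) inside (p , q).
cut : ∀ {p q} → p ℚ.< q → ℕ → Σ ℚ (p ℚ.<_)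
cut {p} {q} p<q zero    = q , p<q
cut {p} {q} p<q (suc m) =
  let (c , p<c , _) = ℚ.<-dense (proj₂ (cut p<q m)) in c , p<c

cutPoint : ∀ {p q} → p ℚ.< q → ℕ → ℚ
cutPoint p<q m = proj₁ (cut p<q m)

cutPoint-step : ∀ {p q} (p<q : p ℚ.< q) m → cutPoint p<q (suc m) ℚ.< cutPoint p<q m
cutPoint-step p<q m = proj₂ (proj₂ (ℚ.<-dense (proj₂ (cut p<q m))))

cutPoint-antitone : ∀ {p q} (p<q : p ℚ.< q) {m m′} → m ≤ m′ →
  cutPoint p<q m′ ℚ.≤ cutPoint p<q m
cutPoint-antitone p<q {m} {zero} z≤n = ℚ.≤-refl
cutPoint-antitone p<q {m} {suc m′} m≤ with m≤n⇒m<n∨m≡n m≤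
... | inj₁ (s≤s m≤m′) =
  ℚ.≤-trans (ℚ.<⇒≤ (cutPoint-step p<q m′)) (cutPoint-antitone p<q m≤m′)
... | inj₂ refl = ℚ.≤-refl

Piece : ∀ {p q} → p ℚ.< q → ℕ → Pred ℝ 0ℓ
Piece p<q m = Interval (cutPoint p<q (suc m)) (cutPoint p<q m)

pieces-disjoint : ∀ {p q} (p<q : p ℚ.< q) {m m′} x →
  m < m′ → x ∈ Piece p<q m → x ∉ Piece p<q m′
pieces-disjoint p<q x m<m′ (Lx , _) (_ , Ux) =
  ℚ.<-irrefl refl
    (ℚ.<-≤-trans (lower<upper x Lx Ux) (cutPoint-antitone p<q m<m′))

piece-unique : ∀ {p q} (p<q : p ℚ.< q) {m m′} x →
  x ∈ Piece p<q m → x ∈ Piece p<q m′ → m ≡ m′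
piece-unique p<q {m} {m′} x x∈ x∈′ with <-cmp m m′
... | tri< lt _ _   = contradiction x∈′ (pieces-disjoint p<q x lt x∈)
... | tri≈ _ refl _ = refl
... | tri> _ _ gt   = contradiction x∈ (pieces-disjoint p<q x gt x∈′)

ℚ² : Countable (ℚ × ℚ)
ℚ² = ℚ-countable ×-countable ℚ-countable

-- The function of a real x maps the code of (p , q) to the number of the piece
-- of (p , q) that contains x. The reals whose function differs everywhere from f
-- form a nowhere dense set: each interval (p , q) contains a piece on which the value
-- at the code of (p , q) is the one of f.
Misses : (ℕ → ℕ) → Pred ℝ 0ℓ
Misses f x = ∀ p q (p<q : p ℚ.< q) → x ∉ Piece p<q (f (code ℚ² (p , q)))

Misses-respects-≃ : ∀ f {x y} → x ≃ y → x ∈ Misses f → y ∈ Misses f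
Misses-respects-≃ f x≃y misses p q p<q (Ly , Uy) = misses p q p<q
  (Equivalence.from (proj₁ (x≃y _)) Ly , Equivalence.from (proj₂ (x≃y _)) Uy)

Misses-nowhereDense : ∀ f → NowhereDense (Misses f)
Misses-nowhereDense f x (p , q , (Lx , Ux) , dense) =
  let p<q = lower<upper x Lx Ux
      k   = f (code ℚ² (p , q))
      (r , lo<r , r<hi) = ℚ.<-dense (cutPoint-step p<q k)
      (y , y∈ , misses) = dense (fromℚ r)
        ( ℚ.<-trans (proj₂ (cut p<q (suc k))) lo<r
        , ℚ.<-≤-trans r<hi (cutPoint-antitone p<q {0} {k} z≤n))
        (cutPoint p<q (suc k)) (cutPoint p<q k) (lo<r , r<hi)
  in misses p q p<q y∈

module Line (em : ExcludedMiddle (lsuc 0ℓ)) where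
  open Choice em

  Label : ℝ → ℕ → ℕ → Set
  Label x k m =
    Σ (ℚ × ℚ) λ (p , q) → Σ (p ℚ.< q) λ p<q → code ℚ² (p , q) ≡ k × x ∈ Piece p<q m

  label-unique : ∀ x {k m m′} → Label x k m → Label x k m′ → m ≡ m′
  label-unique x (pq , p<q , eq , x∈) (pq′ , p<q′ , eq′ , x∈′)
    with refl ← code-injective ℚ² {pq} {pq′} (trans eq (sym eq′))
    with refl ← ℚ.<-irrelevant p<q p<q′ = piece-unique p<q x x∈ x∈′

  label : ℝ → ℕ → ℕ
  label x k with dec (Σ ℕ (Label x k))
  ... | yes (m , _) = m
  ... | no _        = 0

  label-correct : ∀ x {k m} → Label x k m → label x k ≡ m
  label-correct x {k} {m} l with dec (Σ ℕ (Label x k))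
  ... | yes (m′ , l′) = label-unique x l′ l
  ... | no none       = contradiction (m , l) none

  -- A real outside all sets Misses (f j) has a function that meets every f j.
  ¬CoversLine⇒Guessable : ∀ {J} → ¬ CoversLine J → Guessable J
  ¬CoversLine⇒Guessable {J} ¬covers f = byContradiction λ none →
    ¬covers (Misses ∘ f , (λ j {x} {y} → Misses-respects-≃ (f j) {x} {y}) ,
             (λ j → Misses-nowhereDense (f j)) ,
             λ x → byContradiction λ missed → none (label x , hit x missed))
    where
    hit : ∀ x → ¬ (∃[ j ] x ∈ Misses (f j)) → ∀ j → ∃[ k ] label x k ≡ f j k
    hit x missed j = byContradiction λ never → missed (j , λ p q p<q x∈ →
      never (code ℚ² (p , q) , label-correct x ((p , q) , p<q , refl , x∈)))

  -- If the line were covered by I many sets, minimality would embed κ in I.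
  ≺-covK⇒Guessable : ∀ {κ I} → IsCovK κ → I ≺ κ → Guessable I
  ≺-covK⇒Guessable (_ , least) (_ , κ⋠I) = ¬CoversLine⇒Guessable (κ⋠I ∘ least _)

-- Descending chains meeting many dense sets

module Generic
  (em : ExcludedMiddle (lsuc 0ℓ))
  {J : Set} (guess : Guessable J)
  {P : Set} (π : Countable P)
  {C : Set} (γ : Countable C)
  (_⊑_ : P → P → Set)
  (⊑-refl : ∀ p → p ⊑ p)
  (⊑-trans : ∀ {p q r} → p ⊑ q → q ⊑ r → p ⊑ r)
  (Ok : P → Set₁)
  (D : J → C → P → Set₁)
  (D-open : ∀ j c {p q} → q ⊑ p → D j c p → D j c q)
  (D-dense : ∀ j c p → Ok p → Σ P λ q → q ⊑ p × Ok q × D j c q)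
  where

  open Choice em
  open Guessing guess

  -- The open sets for the finitely many c of code at most ℓ are entered one after
  -- the other.
  refine : ∀ j ℓ p → Ok p → Σ P λ q → q ⊑ p × Ok q × (∀ c → code γ c ≤ ℓ → D j c q)
  refine-one : ∀ j ℓ p → Ok p → Σ P λ q → q ⊑ p × Ok q × (∀ c → code γ c ≡ ℓ → D j c q)

  refine-one j ℓ p ok with dec (Σ C λ c → code γ c ≡ ℓ)
  ... | no none = p , ⊑-refl p , ok , λ c eq → contradiction (c , eq) none
  ... | yes (c , eq) with D-dense j c p ok
  ... | q , q⊑p , ok′ , d = q , q⊑p , ok′ , λ c′ eq′ →
    subst (λ c → D j c q) (code-injective γ (trans eq (sym eq′))) d

  refine j zero p ok with refine-one j zero p ok
  ... | q , q⊑p , ok′ , d = q , q⊑p , ok′ , λ c c≤ → d c (n≤0⇒n≡0 c≤)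
  refine j (suc ℓ) p ok with refine j ℓ p ok
  ... | q , q⊑p , ok′ , d with refine-one j (suc ℓ) q ok′
  ... | r , r⊑q , ok″ , d′ = r , ⊑-trans r⊑q q⊑p , ok″ , both
    where
    both : ∀ c → code γ c ≤ suc ℓ → D j c r
    both c c≤ with m≤n⇒m<n∨m≡n c≤
    ... | inj₁ (s≤s c≤ℓ) = D-open j c r⊑q (d c c≤ℓ)
    ... | inj₂ eq        = d′ c eq

  strategy : J → ℕ → P → P
  strategy j ℓ p with em {Ok p}
  ... | yes ok = proj₁ (refine j ℓ p ok)
  ... | no _   = p

  strategy-correct : ∀ j ℓ p → Ok p →
    strategy j ℓ p ⊑ p × Ok (strategy j ℓ p) × (∀ c → code γ c ≤ ℓ → D j c (strategy j ℓ p))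
  strategy-correct j ℓ p ok with em {Ok p}
  ... | yes ok′ = proj₂ (refine j ℓ p ok′)
  ... | no ¬ok  = contradiction ok ¬ok

  -- A guess has to be a countable datum, so a strategy is guessed only on the finitely
  -- many arguments of bounded code; finite lists of pairs are countable.
  boundedGraph : (P → P) → ℕ → List (P × P)
  boundedGraph f zero with dec (Σ P λ p → code π p ≡ zero)
  ... | yes (p , _) = (p , f p) ∷ []
  ... | no _        = []
  boundedGraph f (suc ℓ) with dec (Σ P λ p → code π p ≡ suc ℓ)
  ... | yes (p , _) = (p , f p) ∷ boundedGraph f ℓ
  ... | no _        = boundedGraph f ℓ

  boundedGraph-complete : ∀ f ℓ p → code π p ≤ ℓ → (p , f p) ∈ˡ boundedGraph f ℓ
  boundedGraph-complete f zero p p≤ with dec (Σ P λ p → code π p ≡ 0)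
  ... | no none = contradiction (p , n≤0⇒n≡0 p≤) none
  ... | yes (p′ , eq) with code-injective π (trans eq (sym (n≤0⇒n≡0 p≤)))
  ... | refl = here refl
  boundedGraph-complete f (suc ℓ) p p≤ with dec (Σ P λ p → code π p ≡ suc ℓ) | m≤n⇒m<n∨m≡n p≤
  ... | yes _         | inj₁ (s≤s p≤ℓ) = there (boundedGraph-complete f ℓ p p≤ℓ)
  ... | no _          | inj₁ (s≤s p≤ℓ) = boundedGraph-complete f ℓ p p≤ℓ
  ... | no none       | inj₂ eq        = contradiction (p , eq) none
  ... | yes (p′ , eq) | inj₂ eq′ with code-injective π (trans eq (sym eq′))
  ... | refl = here refl

  boundedGraph-sound : ∀ f ℓ {p q} → (p , q) ∈ˡ boundedGraph f ℓ → q ≡ f p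
  boundedGraph-sound f zero m with dec (Σ P λ p → code π p ≡ 0)
  boundedGraph-sound f zero (here refl) | yes _ = refl
  boundedGraph-sound f (suc ℓ) m with dec (Σ P λ p → code π p ≡ suc ℓ)
  boundedGraph-sound f (suc ℓ) (here refl) | yes _ = refl
  boundedGraph-sound f (suc ℓ) (there m)   | yes _ = boundedGraph-sound f ℓ m
  boundedGraph-sound f (suc ℓ) m           | no _  = boundedGraph-sound f ℓ m

  weight : List (P × P) → ℕ
  weight []             = 0
  weight ((_ , q) ∷ es) = code π q + weight es

  ≤-weight : ∀ {p q es} → (p , q) ∈ˡ es → code π q ≤ weight es
  ≤-weight (here refl) = m≤m+n _ _
  ≤-weight {es = (_ , q) ∷ es} (there m) = ≤-trans (≤-weight m) (m≤n+m _ (code π q))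

  table : J → ℕ → List (P × P)
  table j ℓ = boundedGraph (strategy j ℓ) ℓ

  -- Bounds the codes of the answers of a strategy to arguments of code at most ℓ. The
  -- running sum makes it monotone in ℓ.
  growth : J → ℕ → ℕ
  growth j = total (weight ∘ table j)

  opaque
    -- At time t the chain is at an element of code at most b t, and follows
    -- the guess g t whenever that leads to an admissible element of code at most b (suc t).
    -- For given j and c there is a time t ≥ code γ c at which g t is the
    -- strategy of j on all possible positions and b (suc t) bounds its answers. The
    -- chain then follows the strategy and enters D j c.
    generic : ∀ p₀ → Ok p₀ → Σ (ℕ → P) λ x →
      (∀ t → Ok (x t)) × (∀ t → x (suc t) ⊑ x t) ×
      (∀ j c → ∃[ t ] D j c (x t))
    generic p₀ ok₀ = x , x-ok , x-descending , meets
      where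
      bounds : Σ (ℕ → ℕ) λ b → b 0 ≡ code π p₀ × (∀ t → t ≤ b t) ×
        (∀ t → b t ≤ b (suc t)) × (∀ j N → ∃[ t ] N ≤ t × growth j (b t) ≤ b (suc t))
      bounds = outgrow growth (λ j → total-mono (weight ∘ table j)) (code π p₀)

      b : ℕ → ℕ
      b = proj₁ bounds

      guesses : Σ (ℕ → List (P × P)) λ g → ∀ j N →
        ∃[ t ] N ≤ t × growth j (b t) ≤ b (suc t) × g t ≡ table j (b t)
      guesses = guess-within (List-countable (π ×-countable π)) []
        (λ j t → growth j (b t) ≤ b (suc t))
        (proj₂ (proj₂ (proj₂ (proj₂ bounds))))
        (λ j t → table j (b t))

      g : ℕ → List (P × P)
      g = proj₁ guesses

      Move : ℕ → P → Set₁
      Move t p = Σ P λ q → (p , q) ∈ˡ g t × code π q ≤ b (suc t) × q ⊑ p × Ok q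

      next : ℕ → P → P
      next t p with em {Move t p}
      ... | yes (q , _) = q
      ... | no _        = p

      x : ℕ → P
      x zero    = p₀
      x (suc t) = next t (x t)

      next-ok : ∀ t p → Ok p → Ok (next t p)
      next-ok t p ok with em {Move t p}
      ... | yes (_ , _ , _ , _ , ok′) = ok′
      ... | no _                      = ok

      next-⊑ : ∀ t p → next t p ⊑ p
      next-⊑ t p with em {Move t p}
      ... | yes (_ , _ , _ , q⊑p , _) = q⊑p
      ... | no _                      = ⊑-refl p

      next-bounded : ∀ t p → code π p ≤ b t → code π (next t p) ≤ b (suc t)
      next-bounded t p p≤ with em {Move t p}
      ... | yes (_ , _ , q≤ , _) = q≤
      ... | no _                 = ≤-trans p≤ (proj₁ (proj₂ (proj₂ (proj₂ bounds))) t)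

      next-follows : ∀ t p → Move t p → (p , next t p) ∈ˡ g t
      next-follows t p m with em {Move t p}
      ... | yes (_ , q∈ , _) = q∈
      ... | no none          = contradiction m none

      x-ok : ∀ t → Ok (x t)
      x-ok zero    = ok₀
      x-ok (suc t) = next-ok t (x t) (x-ok t)

      x-descending : ∀ t → x (suc t) ⊑ x t
      x-descending t = next-⊑ t (x t)

      x-bounded : ∀ t → code π (x t) ≤ b t
      x-bounded zero    = ≤-reflexive (sym (proj₁ (proj₂ bounds)))
      x-bounded (suc t) = next-bounded t (x t) (x-bounded t)

      meets : ∀ j c → ∃[ t ] D j c (x t)
      meets j c with proj₂ guesses j (code γ c)
      ... | t , c≤t , fast , eq = suc t ,
        subst (D j c) (sym follows)
          (proj₂ (proj₂ (strategy-correct j (b t) (x t) (x-ok t))) c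
            (≤-trans c≤t (proj₁ (proj₂ (proj₂ bounds)) t)))
        where
        q : P
        q = strategy j (b t) (x t)
        q∈ : (x t , q) ∈ˡ table j (b t)
        q∈ = boundedGraph-complete (strategy j (b t)) (b t) (x t) (x-bounded t)
        move : Move t (x t)
        move = q , subst ((x t , q) ∈ˡ_) (sym eq) q∈ ,
          ≤-trans (≤-trans (≤-weight q∈) (≤-total-sum (weight ∘ table j) {b t} ≤-refl)) fast ,
          proj₁ (strategy-correct j (b t) (x t) (x-ok t)) ,
          proj₁ (proj₂ (strategy-correct j (b t) (x t) (x-ok t)))
        follows : next t (x t) ≡ q
        follows = boundedGraph-sound (strategy j (b t)) (b t)
          (subst ((x t , next t (x t)) ∈ˡ_) eq (next-follows t (x t) move))

-- Tuples and transformations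

lookup-extensional : ∀ {M : Set} {n} {s t : Vec M n} →
  (∀ i → lookup s i ≡ lookup t i) → s ≡ t
lookup-extensional {s = s} {t} eq =
  trans (sym (tabulate∘lookup s)) (trans (tabulate-cong eq) (tabulate∘lookup t))

lookup-⊙ : ∀ {M : Set} {n} (s : Vec M n) τ i → lookup (s ⊙ τ) i ≡ lookup s (lookup τ i)
lookup-⊙ s τ i = lookup-map i (lookup s) τ

map-⊙ : ∀ {M N : Set} {n} (a : M → N) (s : Vec M n) τ → map a (s ⊙ τ) ≡ map a s ⊙ τ
map-⊙ a s τ = trans (sym (map-∘ a (lookup s) τ))
  (map-cong (λ i → sym (lookup-map i a s)) τ)

⊙-assoc : ∀ {M : Set} {n} (s : Vec M n) τ σ → s ⊙ (τ ⊙ σ) ≡ (s ⊙ τ) ⊙ σ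
⊙-assoc s τ σ = map-⊙ (lookup s) τ σ

⊙-identity : ∀ {M : Set} {n} (s : Vec M n) → s ⊙ allFin n ≡ s
⊙-identity = map-lookup-allFin

lookup-replace : ∀ {n} (i j : Fin n) → lookup [ i ∣ j ] i ≡ j
lookup-replace i j = lookup∘update i (allFin _) j

lookup-replace-other : ∀ {n} {i k : Fin n} j → k ≢ i → lookup [ i ∣ j ] k ≡ k
lookup-replace-other {k = k} j k≢i = trans (lookup∘update′ k≢i (allFin _) j) (lookup-allFin k)

transpose-left : ∀ {n} (i j : Fin n) → transpose i j i ≡ j
transpose-left i j with i ≟ᶠ i
... | yes _   = refl
... | no i≢i  = contradiction refl i≢i

transpose-other : ∀ {n} {i j k : Fin n} → k ≢ i → k ≢ j → transpose i j k ≡ k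
transpose-other {i = i} {j} {k} k≢i k≢j with k ≟ᶠ i
... | yes eq = contradiction eq k≢i
... | no _ with k ≟ᶠ j
... | yes eq = contradiction eq k≢j
... | no _   = refl

⟨_⇄_⟩ : ∀ {n} → Fin n → Fin n → Vec (Fin n) n
⟨ a ⇄ b ⟩ = tabulate (transpose a b)

lookup-⊙-swap : ∀ {M : Set} {n} (s : Vec M n) a b i →
  lookup (s ⊙ ⟨ a ⇄ b ⟩) i ≡ lookup s (transpose a b i)
lookup-⊙-swap s a b i =
  trans (lookup-⊙ s ⟨ a ⇄ b ⟩ i) (cong (lookup s) (lookup∘tabulate (transpose a b) i))

⊙-swap-inverse : ∀ {M : Set} {n} (s : Vec M n) a b → (s ⊙ ⟨ a ⇄ b ⟩) ⊙ ⟨ b ⇄ a ⟩ ≡ s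
⊙-swap-inverse s a b = lookup-extensional λ i →
  trans (lookup-⊙-swap (s ⊙ ⟨ a ⇄ b ⟩) b a i)
    (trans (lookup-⊙-swap s a b (transpose b a i))
      (cong (lookup s) (transpose-inverse a b)))

transpose-injective : ∀ {n} (a b : Fin n) {i j} → transpose a b i ≡ transpose a b j → i ≡ j
transpose-injective a b eq =
  trans (sym (transpose-inverse b a)) (trans (cong (transpose b a) eq) (transpose-inverse b a))

module Units (em : ExcludedMiddle (lsuc 0ℓ)) where
  open Choice em

  module _ {M : Set} {n} (i₀ : Fin n) {V : Pred (Vec M n) 0ℓ}
    (replace : ∀ s → s ∈ V → ∀ i j → (s ⊙ [ i ∣ j ]) ∈ V)
    (swap : ∀ s → s ∈ V → ∀ a b → (s ⊙ ⟨ a ⇄ b ⟩) ∈ V)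
    (τ : Vec (Fin n) n) where

    -- A choice of one index in each class of indices on which τ agrees.
    rep : Fin n → Fin n
    rep j = preimage (lookup τ) i₀ (lookup τ j)

    τ-rep : ∀ j → lookup τ (rep j) ≡ lookup τ j
    τ-rep = preimage-correct (lookup τ) i₀

    rep-cong : ∀ {i j} → lookup τ i ≡ lookup τ j → rep i ≡ rep j
    rep-cong = cong (preimage (lookup τ) i₀)

    Closed : Vec (Fin n) n → Set
    Closed σ = ∀ s → s ∈ V → (s ⊙ σ) ∈ V

    Closed-⊙ : ∀ {σ ρ} → Closed σ → Closed ρ → Closed (σ ⊙ ρ)
    Closed-⊙ {σ} {ρ} cσ cρ s s∈ = subst V (sym (⊙-assoc s σ ρ)) (cρ _ (cσ s s∈))

    Closed-id : Closed (allFin n)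
    Closed-id s = subst V (sym (⊙-identity s))

    -- The restriction of τ to the representatives is injective. It is extended to a
    -- permutation by interchanges: at a representative x, interchange x with the
    -- index q that is at present sent to lookup τ x. Ontoness provides q, and q is not a
    -- representative treated earlier, since those already have their own τ-value.
    permutation : (xs : List (Fin n)) → Σ (Vec (Fin n) n) λ π → Closed π ×
      (∀ y → ∃[ x ] lookup π x ≡ y) ×
      (∀ j → j ∈ˡ xs → rep j ≡ j → lookup π j ≡ lookup τ j)
    permutation [] = allFin n , Closed-id , (λ y → y , lookup-allFin y) , λ _ ()
    permutation (x ∷ xs) with permutation xs | rep x ≟ᶠ x
    ... | π , cπ , onto , agree | no moved = π , cπ , onto , λ where
      j (here refl) fixed → contradiction fixed moved
      j (there j∈)  fixed → agree j j∈ fixed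
    ... | π , cπ , onto , agree | yes fixedˣ with onto (lookup τ x)
    ... | q , πq = π′ , Closed-⊙ {π} cπ (λ s s∈ → swap s s∈ x q) , onto′ , agree′
      where
      π′ : Vec (Fin n) n
      π′ = π ⊙ ⟨ x ⇄ q ⟩
      onto′ : ∀ y → ∃[ z ] lookup π′ z ≡ y
      onto′ y = let (z , πz) = onto y in transpose q x z ,
        trans (lookup-⊙-swap π x q _) (trans (cong (lookup π) (transpose-inverse x q)) πz)
      agree′ : ∀ j → j ∈ˡ (x ∷ xs) → rep j ≡ j → lookup π′ j ≡ lookup τ j
      agree′ j j∈ fixed with j ≟ᶠ x
      agree′ j j∈ fixed | yes refl =
        trans (lookup-⊙-swap π x q x) (trans (cong (lookup π) (transpose-left x q)) πq)
      agree′ j (here eq) fixed | no j≢x = contradiction eq j≢x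
      agree′ j (there j∈) fixed | no j≢x =
        trans (lookup-⊙-swap π x q j)
          (trans (cong (lookup π) (transpose-other j≢x j≢q)) (agree j j∈ fixed))
        where
        j≢q : j ≢ q
        j≢q refl = j≢x (trans (sym fixed)
          (trans (rep-cong (trans (sym (agree j j∈ fixed)) πq)) fixedˣ))

    -- The map rep is a product of replacements [ x ∣ rep x ]. Representatives stay in
    -- place, so the order of the factors does not matter.
    collapse : (xs : List (Fin n)) → Σ (Vec (Fin n) n) λ ρ → Closed ρ ×
      (∀ j → j ∈ˡ xs → lookup ρ j ≡ rep j) × (∀ j → j ∉ˡ xs → lookup ρ j ≡ j)
    collapse [] = allFin n , Closed-id , (λ _ ()) , λ j _ → lookup-allFin j
    collapse (x ∷ xs) with collapse xs
    ... | ρ , cρ , inside , outside =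
      ρ′ , Closed-⊙ {ρ} cρ (λ s s∈ → replace s s∈ x (rep x)) , inside′ , outside′
      where
      ρ′ : Vec (Fin n) n
      ρ′ = ρ ⊙ [ x ∣ rep x ]
      unmoved : ∀ j → j ≢ x → lookup ρ′ j ≡ lookup ρ j
      unmoved j j≢x = trans (lookup-⊙ ρ [ x ∣ rep x ] j)
        (cong (lookup ρ) (lookup-replace-other (rep x) j≢x))
      ρ-rep : lookup ρ (rep x) ≡ rep x
      ρ-rep with dec (rep x ∈ˡ xs)
      ... | yes r∈ = trans (inside (rep x) r∈) (rep-cong (τ-rep x))
      ... | no r∉  = outside (rep x) r∉
      inside′ : ∀ j → j ∈ˡ (x ∷ xs) → lookup ρ′ j ≡ rep j
      inside′ j j∈ with j ≟ᶠ x
      inside′ j j∈ | yes refl = trans (lookup-⊙ ρ [ x ∣ rep x ] x)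
        (trans (cong (lookup ρ) (lookup-replace x (rep x))) ρ-rep)
      inside′ j (here eq)  | no j≢x = contradiction eq j≢x
      inside′ j (there j∈) | no j≢x = trans (unmoved j j≢x) (inside j j∈)
      outside′ : ∀ j → j ∉ˡ (x ∷ xs) → lookup ρ′ j ≡ j
      outside′ j j∉ = trans (unmoved j (j∉ ∘ here)) (outside j (j∉ ∘ there))

    -- τ is rep followed by a permutation.
    closed : Closed τ
    closed with permutation (List.allFin n) | collapse (List.allFin n)
    ... | π , cπ , _ , agree | ρ , cρ , inside , _ =
      subst Closed factor (Closed-⊙ {π} {ρ} cπ cρ)
      where
      factor : π ⊙ ρ ≡ τ
      factor = lookup-extensional λ j →
        trans (lookup-⊙ π ρ j)
          (trans (cong (lookup π) (inside j (∈ˡ-allFin j)))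
            (trans (agree (rep j) (∈ˡ-allFin (rep j)) (rep-cong (τ-rep j))) (τ-rep j)))

-- Moves between tuples and the formulas expressing them

data Swap (n : ℕ) : Kind → Set where
  swapping : Fin n → Fin n → Swap n 𝖦

swapVec : ∀ {n k} → Swap n k → Vec (Fin n) n
swapVec (swapping a b) = ⟨ a ⇄ b ⟩

reverse : ∀ {n k} → Swap n k → Swap n k
reverse (swapping a b) = swapping b a

-- Interchanges are invertible on the unit, so they commute with relativized
-- quantifiers up to renaming the variable, and can be pushed down to the atoms, where
-- 𝖦 provides substituted relation symbols.
permute : ∀ {n S k} → Swap n k → Formula n S k → Formula n S k
permute (swapping a b) (rel R)    = relₛ R ⟨ a ⇄ b ⟩
permute (swapping a b) (relₛ R τ) = relₛ R (map (transpose a b) τ)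
permute (swapping a b) (i ≐ j)    = transpose a b i ≐ transpose a b j
permute σ              (∼ φ)      = ∼ permute σ φ
permute σ              (φ ∧ ψ)    = permute σ φ ∧ permute σ ψ
permute (swapping a b) (∃x i φ)   = ∃x (transpose a b i) (permute (swapping a b) φ)

module _ {n S k} (𝔐 : Model n S k) where
  open Model 𝔐 using (V)

  swap-∈V : ∀ (σ : Swap n k) {w} → w ∈ V → (w ⊙ swapVec σ) ∈ V
  swap-∈V (swapping a b) {w} w∈ = Model.isUnit 𝔐 w w∈ ⟨ a ⇄ b ⟩

swap-inverse : ∀ {M : Set} {n k} (σ : Swap n k) (w : Vec M n) →
  (w ⊙ swapVec σ) ⊙ swapVec (reverse σ) ≡ w
swap-inverse (swapping a b) w = ⊙-swap-inverse w a b

permute-sound : ∀ {n S k} (𝔐 : Model n S k) (σ : Swap n k) φ w →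
  Sat 𝔐 w (permute σ φ) → Sat 𝔐 (w ⊙ swapVec σ) φ
permute-complete : ∀ {n S k} (𝔐 : Model n S k) (σ : Swap n k) φ w →
  Sat 𝔐 (w ⊙ swapVec σ) φ → Sat 𝔐 w (permute σ φ)

⊙-permute : ∀ {M : Set} {n} (w : Vec M n) a b τ →
  w ⊙ map (transpose a b) τ ≡ (w ⊙ ⟨ a ⇄ b ⟩) ⊙ τ
⊙-permute w a b τ = trans (sym (map-∘ (lookup w) (transpose a b) τ))
  (map-cong (λ i → sym (lookup-⊙-swap w a b i)) τ)

permute-sound 𝔐 (swapping a b) (rel R)    w h = h
permute-sound 𝔐 (swapping a b) (relₛ R τ) w h =
  subst (Model.⟦_⟧ 𝔐 R) (⊙-permute w a b τ) h
permute-sound 𝔐 (swapping a b) (i ≐ j)    w h =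
  trans (lookup-⊙-swap w a b i) (trans h (sym (lookup-⊙-swap w a b j)))
permute-sound 𝔐 σ@(swapping a b) (∼ φ)      w h = h ∘ permute-complete 𝔐 σ φ w
permute-sound 𝔐 σ@(swapping a b) (φ ∧ ψ)    w (h , h′) =
  permute-sound 𝔐 σ φ w h , permute-sound 𝔐 σ ψ w h′
permute-sound 𝔐 σ@(swapping a b) (∃x i φ)   w (u , u∈ , off , h) =
  u ⊙ ⟨ a ⇄ b ⟩ , swap-∈V 𝔐 σ u∈ , off′ , permute-sound 𝔐 σ φ u h
  where
  off′ : ∀ j → j ≢ i → lookup (u ⊙ ⟨ a ⇄ b ⟩) j ≡ lookup (w ⊙ ⟨ a ⇄ b ⟩) j
  off′ j j≢i = trans (lookup-⊙-swap u a b j)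
    (trans (off (transpose a b j) (j≢i ∘ transpose-injective a b))
      (sym (lookup-⊙-swap w a b j)))

permute-complete 𝔐 (swapping a b) (rel R)    w h = h
permute-complete 𝔐 (swapping a b) (relₛ R τ) w h =
  subst (Model.⟦_⟧ 𝔐 R) (sym (⊙-permute w a b τ)) h
permute-complete 𝔐 (swapping a b) (i ≐ j)    w h =
  trans (sym (lookup-⊙-swap w a b i)) (trans h (lookup-⊙-swap w a b j))
permute-complete 𝔐 σ@(swapping a b) (∼ φ)      w h = h ∘ permute-sound 𝔐 σ φ w
permute-complete 𝔐 σ@(swapping a b) (φ ∧ ψ)    w (h , h′) =
  permute-complete 𝔐 σ φ w h , permute-complete 𝔐 σ ψ w h′
permute-complete 𝔐 σ@(swapping a b) (∃x i φ)   w (u , u∈ , off , h) =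
  u ⊙ ⟨ b ⇄ a ⟩ , swap-∈V 𝔐 (reverse σ) u∈ , off′ ,
  permute-complete 𝔐 σ φ (u ⊙ ⟨ b ⇄ a ⟩)
    (subst (λ v → Sat 𝔐 v φ) (sym (⊙-swap-inverse u b a)) h)
  where
  off′ : ∀ j → j ≢ transpose a b i → lookup (u ⊙ ⟨ b ⇄ a ⟩) j ≡ lookup w j
  off′ j j≢ = trans (lookup-⊙-swap u b a j)
    (trans (off (transpose b a j) (λ eq → j≢ (trans (sym (transpose-inverse a b)) (cong (transpose a b) eq))))
      (trans (lookup-⊙-swap w a b (transpose b a j))
        (cong (lookup w) (transpose-inverse a b))))

-- The ways to pass from one tuple of a unit to another that a formula can
-- express. Each is reversible, which is what allows to look at a condition
-- from any of its tuples.
data Move (n : ℕ) (k : Kind) : Set where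
  stay  : Move n k
  shift : Fin n → Move n k
  swap  : Swap n k → Move n k

undo : ∀ {n k} → Move n k → Move n k
undo stay      = stay
undo (shift i) = shift i
undo (swap σ)  = swap (reverse σ)

Related : ∀ {M : Set} {n k} → Move n k → Vec M n → Vec M n → Set
Related stay      w w′ = w′ ≡ w
Related (shift i) w w′ = ∀ j → j ≢ i → lookup w′ j ≡ lookup w j
Related (swap σ)  w w′ = w′ ≡ w ⊙ swapVec σ

Related-undo : ∀ {M : Set} {n k} (m : Move n k) {w w′ : Vec M n} →
  Related m w w′ → Related (undo m) w′ w
Related-undo stay      eq   = sym eq
Related-undo (shift i) off  = λ j j≢i → sym (off j j≢i)
Related-undo (swap σ) {w} refl = sym (swap-inverse σ w)

undo-undo : ∀ {n k} (m : Move n k) → undo (undo m) ≡ m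
undo-undo stay                  = refl
undo-undo (shift i)             = refl
undo-undo (swap (swapping a b)) = refl

undo-Related : ∀ {M : Set} {n k} (m : Move n k) {w w′ : Vec M n} →
  Related (undo m) w w′ → Related m w′ w
undo-Related m {w} {w′} r =
  subst (λ m → Related m w′ w) (undo-undo m) (Related-undo (undo m) r)

◇ : ∀ {n S k} → Move n k → Formula n S k → Formula n S k
◇ stay      φ = φ
◇ (shift i) φ = ∃x i φ
◇ (swap σ)  φ = permute σ φ

◇-elim : ∀ {n S k} (𝔐 : Model n S k) (m : Move n k) {φ w} → w ∈ Model.V 𝔐 →
  Sat 𝔐 w (◇ m φ) → ∃[ w′ ] w′ ∈ Model.V 𝔐 × Related m w w′ × Sat 𝔐 w′ φ
◇-elim 𝔐 stay      w∈ h = _ , w∈ , refl , h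
◇-elim 𝔐 (shift i) w∈ h = h
◇-elim 𝔐 (swap σ) {φ} {w}  w∈ h = _ , swap-∈V 𝔐 σ w∈ , refl , permute-sound 𝔐 σ φ w h

◇-intro : ∀ {n S k} (𝔐 : Model n S k) (m : Move n k) {φ w w′} → w′ ∈ Model.V 𝔐 →
  Related m w w′ → Sat 𝔐 w′ φ → Sat 𝔐 w (◇ m φ)
◇-intro 𝔐 stay      w′∈ refl h = h
◇-intro 𝔐 (shift i) w′∈ off  h = _ , w′∈ , off , h
◇-intro 𝔐 (swap σ) {φ} {w} w′∈ refl h = permute-complete 𝔐 σ φ w h

-- Equality patterns

-- Constants occurring in the same tuple denote different elements, whereas constants
-- of different tuples may well denote the same one.
Alike : ∀ {M N : Set} {n} → Vec M n → Vec N n → Set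
Alike s w = ∀ i j →
  (lookup s i ≡ lookup s j → lookup w i ≡ lookup w j) ×
  (lookup w i ≡ lookup w j → lookup s i ≡ lookup s j)

Alike-⊙ : ∀ {M N : Set} {n} (s : Vec M n) (w : Vec N n) τ →
  Alike s w → Alike (s ⊙ τ) (w ⊙ τ)
Alike-⊙ s w τ alike i j =
  (λ eq → trans (lookup-⊙ w τ i) (trans (proj₁ (alike _ _)
     (trans (sym (lookup-⊙ s τ i)) (trans eq (lookup-⊙ s τ j)))) (sym (lookup-⊙ w τ j)))) ,
  (λ eq → trans (lookup-⊙ s τ i) (trans (proj₂ (alike _ _)
     (trans (sym (lookup-⊙ w τ i)) (trans eq (lookup-⊙ w τ j)))) (sym (lookup-⊙ s τ j))))

module Patterns {n : ℕ} (i₀ : Fin n) {S : Set} {k : Kind} where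

  ⊤ᶠ : Formula n S k
  ⊤ᶠ = i₀ ≐ i₀

  ⋀ : ∀ {m} → (Fin m → Formula n S k) → Formula n S k
  ⋀ {zero}  f = ⊤ᶠ
  ⋀ {suc m} f = f zero ∧ ⋀ (f ∘ suc)

  ⋀-intro : ∀ (𝔐 : Model n S k) w {m} (f : Fin m → Formula n S k) →
    (∀ i → Sat 𝔐 w (f i)) → Sat 𝔐 w (⋀ f)
  ⋀-intro 𝔐 w {zero}  f h = refl
  ⋀-intro 𝔐 w {suc m} f h = h zero , ⋀-intro 𝔐 w (f ∘ suc) (h ∘ suc)

  ⋀-elim : ∀ (𝔐 : Model n S k) w {m} (f : Fin m → Formula n S k) →
    Sat 𝔐 w (⋀ f) → ∀ i → Sat 𝔐 w (f i)
  ⋀-elim 𝔐 w f (h , _)  zero    = h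
  ⋀-elim 𝔐 w f (_ , hs) (suc i) = ⋀-elim 𝔐 w (f ∘ suc) hs i

  patternAt : Vec ℕ n → Fin n → Fin n → Formula n S k
  patternAt s i j with lookup s i ≟ lookup s j
  ... | yes _ = i ≐ j
  ... | no _  = ∼ (i ≐ j)

  pattern-formula : Vec ℕ n → Formula n S k
  pattern-formula s = ⋀ λ i → ⋀ λ j → patternAt s i j

  pattern-sound : ∀ (𝔐 : Model n S k) s w → Sat 𝔐 w (pattern-formula s) → Alike s w
  pattern-sound 𝔐 s w h i j with lookup s i ≟ lookup s j | at
    where
    at : Sat 𝔐 w (patternAt s i j)
    at = ⋀-elim 𝔐 w (patternAt s i) (⋀-elim 𝔐 w (λ i → ⋀ (patternAt s i)) h i) j
  ... | yes eq | e  = (λ _ → e) , λ _ → eq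
  ... | no neq | ne = (λ eq → contradiction eq neq) , λ e → contradiction e ne

  pattern-complete : ∀ (𝔐 : Model n S k) s w → Alike s w → Sat 𝔐 w (pattern-formula s)
  pattern-complete 𝔐 s w alike =
    ⋀-intro 𝔐 w (λ i → ⋀ (patternAt s i)) λ i → ⋀-intro 𝔐 w (patternAt s i) (at i)
    where
    at : ∀ i j → Sat 𝔐 w (patternAt s i j)
    at i j with lookup s i ≟ lookup s j
    ... | yes eq = proj₁ (alike i j) eq
    ... | no neq = neq ∘ proj₂ (alike i j)

-- Conditions

module Conditions (em : ExcludedMiddle (lsuc 0ℓ)) {n : ℕ} (i₀ : Fin n) {S : Set} {k : Kind} where

  open Choice em
  open Patterns i₀ {S} {k}

  Condition : Set
  Condition = List (Vec ℕ n × Formula n S k)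

  _∈dom_ : Vec ℕ n → Condition → Set
  s ∈dom p = ∃[ φ ] (s , φ) ∈ˡ p

  Constant : Condition → ℕ → Set
  Constant p c = ∃[ s ] s ∈dom p × (∃[ i ] lookup s i ≡ c)

  -- How a new tuple may be attached to the tuple s of the condition p. A constant
  -- enters with a single tuple and is handed on only along steps, so the tuples
  -- containing it stay connected. This lets assignments be built step by step.
  data Step (p : Condition) (s : Vec ℕ n) : Move n k → Vec ℕ n → Set where
    again : Step p s stay s
    fresh : ∀ i c → ¬ Constant p c → Step p s (shift i) (s [ i ]≔ c)
    copy  : ∀ i j → j ≢ i → Step p s (shift i) (s ⊙ [ i ∣ j ])
    turn  : ∀ σ → Step p s (swap σ) (s ⊙ swapVec σ)

  data Tree : Condition → Set where
    root : ∀ s φ → Tree ((s , φ) ∷ [])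
    grow : ∀ {p s m t} φ → Tree p → s ∈dom p → Step p s m t → Tree ((t , φ) ∷ p)

  module _ (𝔐 : Model n S k) where
    open Model 𝔐 using (Base; V)

    RealizesAt : (ℕ → Base) → Vec ℕ n → Formula n S k → Set
    RealizesAt a s φ = map a s ∈ V × Alike s (map a s) × Sat 𝔐 (map a s) φ

    Realizes : (ℕ → Base) → Condition → Set
    Realizes a p = ∀ s φ → (s , φ) ∈ˡ p → RealizesAt a s φ

  step-related : ∀ {p s m t} {M : Set} → Step p s m t → (a : ℕ → M) →
    Related m (map a s) (map a t)
  step-related again a = refl
  step-related {s = s} (fresh i c _) a j j≢i =
    trans (lookup-map j a (s [ i ]≔ c)) (trans (cong a (lookup∘update′ j≢i s c)) (sym (lookup-map j a s)))
  step-related {s = s} (copy i l _) a j j≢i =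
    trans (lookup-map j a (s ⊙ [ i ∣ l ]))
      (trans (cong a (trans (lookup-⊙ s [ i ∣ l ] j) (cong (lookup s) (lookup-replace-other l j≢i))))
        (sym (lookup-map j a s)))
  step-related {s = s} (turn σ) a = map-⊙ a s (swapVec σ)

  override : ∀ {M : Set} → (ℕ → M) → ℕ → M → ℕ → M
  override a c b d with d ≟ c
  ... | yes _ = b
  ... | no _  = a d

  override-at : ∀ {M : Set} (a : ℕ → M) c b → override a c b c ≡ b
  override-at a c b with c ≟ c
  ... | yes _  = refl
  ... | no c≢c = contradiction refl c≢c

  override-off : ∀ {M : Set} (a : ℕ → M) {c} b {d} → d ≢ c → override a c b d ≡ a d
  override-off a {c} b {d} d≢c with d ≟ c
  ... | yes eq = contradiction eq d≢c
  ... | no _   = refl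

  -- A step made in a model lifts to assignments. Only a fresh constant is reassigned, and
  -- it does not occur in earlier tuples; in the case of a copy the pattern of the new
  -- tuple determines the remaining coordinate.
  step-realize : ∀ {p s m t} {M : Set} → s ∈dom p → Step p s m t → (a : ℕ → M) → ∀ w →
    Related m (map a s) w → Alike t w →
    Σ (ℕ → M) λ a′ → (∀ u → u ∈dom p → map a′ u ≡ map a u) × map a′ t ≡ w
  step-realize s∈ again a w eq alike = a , (λ _ _ → refl) , sym eq
  step-realize {s = s} s∈ (turn σ) a w eq alike =
    a , (λ _ _ → refl) , trans (map-⊙ a s (swapVec σ)) (sym eq)
  step-realize {s = s} s∈ (copy i j j≢i) a w off alike =
    a , (λ _ _ → refl) , lookup-extensional at
    where
    at-j : ∀ l → l ≢ i → lookup (map a (s ⊙ [ i ∣ j ])) l ≡ lookup w l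
    at-j l l≢i = trans (lookup-map l a (s ⊙ [ i ∣ j ]))
      (trans (cong a (trans (lookup-⊙ s [ i ∣ j ] l) (cong (lookup s) (lookup-replace-other j l≢i))))
        (trans (sym (lookup-map l a s)) (sym (off l l≢i))))
    same : lookup (s ⊙ [ i ∣ j ]) i ≡ lookup (s ⊙ [ i ∣ j ]) j
    same = trans (lookup-⊙ s [ i ∣ j ] i)
      (trans (cong (lookup s) (trans (lookup-replace i j) (sym (lookup-replace-other j j≢i))))
        (sym (lookup-⊙ s [ i ∣ j ] j)))
    at : ∀ l → lookup (map a (s ⊙ [ i ∣ j ])) l ≡ lookup w l
    at l with l ≟ᶠ i
    ... | no l≢i   = at-j l l≢i
    ... | yes refl = trans (lookup-map l a (s ⊙ [ i ∣ j ])) (trans (cong a same)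
      (trans (sym (lookup-map j a (s ⊙ [ i ∣ j ]))) (trans (at-j j j≢i) (sym (proj₁ (alike i j) same)))))
  step-realize {p} {s} s∈ (fresh i c new) a w off alike =
    a′ , agree , lookup-extensional at
    where
    a′ = override a c (lookup w i)
    agree : ∀ u → u ∈dom p → map a′ u ≡ map a u
    agree u u∈ = lookup-extensional λ j → trans (lookup-map j a′ u)
      (trans (override-off a (lookup w i) (λ eq → new (u , u∈ , j , eq))) (sym (lookup-map j a u)))
    at : ∀ l → lookup (map a′ (s [ i ]≔ c)) l ≡ lookup w l
    at l with l ≟ᶠ i
    ... | yes refl = trans (lookup-map l a′ (s [ i ]≔ c))
      (trans (cong a′ (lookup∘update i s c)) (override-at a c (lookup w i)))
    ... | no l≢i = trans (lookup-map l a′ (s [ i ]≔ c)) (trans (cong a′ (lookup∘update′ l≢i s c))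
      (trans (sym (lookup-map l a′ s)) (trans (cong (λ v → lookup v l) (agree s s∈)) (sym (off l l≢i)))))

  realizes-grow : ∀ (𝔐 : Model n S k) {p s m t φ a w} → s ∈dom p → Step p s m t →
    Realizes 𝔐 a p → Related m (map a s) w → w ∈ Model.V 𝔐 → Alike t w → Sat 𝔐 w φ →
    Σ (ℕ → Model.Base 𝔐) λ a′ → Realizes 𝔐 a′ ((t , φ) ∷ p) ×
      (∀ u → u ∈dom p → map a′ u ≡ map a u) × map a′ t ≡ w
  realizes-grow 𝔐 {p} {s} {m} {t} {φ} {a} {w} s∈ step real related w∈ alike h
    with step-realize s∈ step a w related alike
  ... | a′ , agree , refl = a′ , real′ , agree , refl
    where
    real′ : Realizes 𝔐 a′ ((t , φ) ∷ p)
    real′ _ _ (here refl) = w∈ , alike , h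
    real′ u ψ (there u∈)  =
      subst (λ v → v ∈ Model.V 𝔐 × Alike u v × Sat 𝔐 v ψ) (sym (agree u (ψ , u∈))) (real u ψ u∈)

  realize-tuple : ∀ {M : Set} → M → (s : Vec ℕ n) (w : Vec M n) → Alike s w →
    Σ (ℕ → M) λ a → map a s ≡ w
  realize-tuple b s w alike = a , lookup-extensional λ i → trans (lookup-map i a s)
      (proj₁ (alike _ i) (preimage-correct (lookup s) i₀ i))
    where
    a : ℕ → _
    a c = lookup w (preimage (lookup s) i₀ c)

  -- Additional demands on the tuples of a condition, used to move what a branch says
  -- to the tuple that the branch is attached to.
  Decoration : Set
  Decoration = Vec ℕ n → Formula n S k

  _≟ᵛ_ : (s t : Vec ℕ n) → Dec (s ≡ t)
  _≟ᵛ_ = ≡-dec _≟_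

  strengthen : Decoration → Vec ℕ n → Formula n S k → Decoration
  strengthen L s χ u with u ≟ᵛ s
  ... | yes _ = L u ∧ χ
  ... | no _  = L u

  module _ (𝔐 : Model n S k) where

    strengthen-weaker : ∀ L s χ u {w} → Sat 𝔐 w (strengthen L s χ u) → Sat 𝔐 w (L u)
    strengthen-weaker L s χ u h with u ≟ᵛ s
    ... | yes _ = proj₁ h
    ... | no _  = h

    strengthen-at : ∀ L s χ {w} → Sat 𝔐 w (strengthen L s χ s) → Sat 𝔐 w χ
    strengthen-at L s χ h with s ≟ᵛ s
    ... | yes _  = proj₂ h
    ... | no s≢s = contradiction refl s≢s

    strengthen-intro : ∀ L s χ u {w} → Sat 𝔐 w (L u) → (u ≡ s → Sat 𝔐 w χ) →
      Sat 𝔐 w (strengthen L s χ u)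
    strengthen-intro L s χ u h h′ with u ≟ᵛ s
    ... | yes eq = h , h′ eq
    ... | no _   = h

    Decorates : Decoration → (ℕ → Model.Base 𝔐) → Condition → Set
    Decorates L a p = ∀ u → u ∈dom p → Sat 𝔐 (map a u) (L u)

    Extends : Condition → Decoration → Vec ℕ n → Vec (Model.Base 𝔐) n → Set
    Extends p L v w = Σ (ℕ → Model.Base 𝔐) λ a →
      map a v ≡ w × Realizes 𝔐 a p × Decorates L a p

  Describes : Formula n S k → Condition → Decoration → Vec ℕ n → Set₁
  Describes Ψ p L v = ∀ 𝔐 w → w ∈ Model.V 𝔐 →
    (Sat 𝔐 w Ψ → Extends 𝔐 p L v w) × (Extends 𝔐 p L v w → Sat 𝔐 w Ψ)

  -- What a condition says about one of its tuples v is a single formula, although the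
  -- condition speaks of arbitrarily many constants. Remove the last tuple t, attached to s by m.
  -- If v is not t, the assertions about t amount to ◇ m χ at s. If v is t, look back
  -- from t: the rest of the condition is described at s, and is seen from t
  -- through the reverse of m.
  describe : ∀ {p} → Tree p → ∀ L v → v ∈dom p → ∃[ Ψ ] Describes Ψ p L v
  describe (root s φ) L _ (_ , here refl) = Ψ , λ 𝔐 w w∈ → sound 𝔐 w w∈ , complete 𝔐 w
    where
    Ψ = φ ∧ pattern-formula s ∧ L s
    sound : ∀ 𝔐 w → w ∈ Model.V 𝔐 → Sat 𝔐 w Ψ → Extends 𝔐 ((s , φ) ∷ []) L s w
    sound 𝔐 w w∈ (h , hp , hL)
      with realize-tuple (Model.nonempty 𝔐) s w (pattern-sound 𝔐 s w hp)
    ... | a , refl = a , refl ,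
      (λ { _ _ (here refl) → w∈ , pattern-sound 𝔐 s w hp , h }) ,
      (λ { _ (_ , here refl) → hL })
    complete : ∀ 𝔐 w → Extends 𝔐 ((s , φ) ∷ []) L s w → Sat 𝔐 w Ψ
    complete 𝔐 w (a , refl , real , deco) with real s φ (here refl)
    ... | _ , alike , h =
      h , pattern-complete 𝔐 s (map a s) alike , deco s (φ , here refl)
  describe (grow {p} {s} {m} {t} φ tree s∈ step) L v v∈ = go (v ≟ᵛ t)
    where
    p′ : Condition
    p′ = (t , φ) ∷ p

    χ : Formula n S k
    χ = φ ∧ pattern-formula t ∧ L t

    leaf : ∀ 𝔐 {a} → Realizes 𝔐 a p′ → Decorates 𝔐 L a p′ → Sat 𝔐 (map a t) χ
    leaf 𝔐 {a} real deco with real t φ (here refl)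
    ... | _ , alike , h =
      h , pattern-complete 𝔐 t (map a t) alike , deco t (φ , here refl)

    below : ∀ 𝔐 {a} → Realizes 𝔐 a p′ → Realizes 𝔐 a p
    below 𝔐 real u ψ u∈ = real u ψ (there u∈)

    attach : ∀ 𝔐 {a w} → w ∈ Model.V 𝔐 → Related m (map a s) w → Sat 𝔐 w χ →
      Realizes 𝔐 a p → Decorates 𝔐 L a p →
      Σ (ℕ → Model.Base 𝔐) λ a′ → Realizes 𝔐 a′ p′ × Decorates 𝔐 L a′ p′ ×
        (∀ u → u ∈dom p → map a′ u ≡ map a u) × map a′ t ≡ w
    attach 𝔐 {w = w} w∈ related (h , hp , hL) real deco
      with realizes-grow 𝔐 {φ = φ} s∈ step real related w∈ (pattern-sound 𝔐 t w hp) h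
    ... | a′ , real′ , agree , refl = a′ , real′ , deco′ , agree , refl
      where
      deco′ : Decorates 𝔐 L a′ p′
      deco′ _ (_ , here refl) = hL
      deco′ u (ψ , there u∈)  =
        subst (λ x → Sat 𝔐 x (L u)) (sym (agree u (ψ , u∈))) (deco u (ψ , u∈))

    go : Dec (v ≡ t) → ∃[ Ψ ] Describes Ψ p′ L v
    go (yes refl) with describe tree L s s∈
    ... | Ψ , correct = χ ∧ ◇ (undo m) Ψ , λ 𝔐 w w∈ → sound 𝔐 w w∈ , complete 𝔐 w
      where
      sound : ∀ 𝔐 w → w ∈ Model.V 𝔐 → Sat 𝔐 w (χ ∧ ◇ (undo m) Ψ) → Extends 𝔐 p′ L t w
      sound 𝔐 w w∈ (hχ , hΨ) with ◇-elim 𝔐 (undo m) w∈ hΨ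
      ... | w₀ , w₀∈ , related , h₀ with proj₁ (correct 𝔐 w₀ w₀∈) h₀
      ... | a , refl , real , deco
        with attach 𝔐 w∈ (undo-Related m related) hχ real deco
      ... | a′ , real′ , deco′ , _ , eq = a′ , eq , real′ , deco′
      complete : ∀ 𝔐 w → Extends 𝔐 p′ L t w → Sat 𝔐 w (χ ∧ ◇ (undo m) Ψ)
      complete 𝔐 w (a , refl , real , deco) = leaf 𝔐 real deco ,
        ◇-intro 𝔐 (undo m) s∈V (Related-undo m (step-related step a))
          (proj₂ (correct 𝔐 (map a s) s∈V)
            (a , refl , below 𝔐 real , λ u (ψ , u∈) → deco u (ψ , there u∈)))
        where
        s∈V : map a s ∈ Model.V 𝔐
        s∈V = proj₁ (real s (proj₁ s∈) (there (proj₂ s∈)))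
    go (no v≢t) with describe tree (strengthen L s (◇ m χ)) v (old v∈)
      where
      old : v ∈dom p′ → v ∈dom p
      old (_ , here refl) = contradiction refl v≢t
      old (ψ , there v∈)  = ψ , v∈
    ... | Ψ , correct = Ψ , λ 𝔐 w w∈ →
      (λ h → sound 𝔐 w (proj₁ (correct 𝔐 w w∈) h)) ,
      (λ e → proj₂ (correct 𝔐 w w∈) (complete 𝔐 w e))
      where
      L′ : Decoration
      L′ = strengthen L s (◇ m χ)
      v∈p : v ∈dom p′ → v ∈dom p
      v∈p (_ , here refl) = contradiction refl v≢t
      v∈p (ψ , there v∈)  = ψ , v∈
      sound : ∀ 𝔐 w → Extends 𝔐 p L′ v w → Extends 𝔐 p′ L v w
      sound 𝔐 w (a , eq , real , deco)
        with ◇-elim 𝔐 m (proj₁ (real s (proj₁ s∈) (proj₂ s∈)))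
               (strengthen-at 𝔐 L s (◇ m χ) (deco s s∈))
      ... | w′ , w′∈ , related , h
        with attach 𝔐 w′∈ related h real
               (λ u u∈ → strengthen-weaker 𝔐 L s (◇ m χ) u (deco u u∈))
      ... | a′ , real′ , deco′ , agree , _ =
        a′ , trans (agree v (v∈p v∈)) eq , real′ , deco′
      complete : ∀ 𝔐 w → Extends 𝔐 p′ L v w → Extends 𝔐 p L′ v w
      complete 𝔐 w (a , eq , real , deco) = a , eq , below 𝔐 real , λ u (ψ , u∈) →
        strengthen-intro 𝔐 L s (◇ m χ) u (deco u (ψ , there u∈)) λ { refl →
          ◇-intro 𝔐 m (proj₁ (real t φ (here refl))) (step-related step a) (leaf 𝔐 real deco) }

-- The generic model

data Action (n : ℕ) (S : Set) (k : Kind) : Set where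
  decide  : Formula n S k → Action n S k
  witness : Fin n → Formula n S k → Action n S k
  turn    : Swap n k → Action n S k

Swap-countable : ∀ {n k} → Countable (Swap n k)
Swap-countable = mk↣ {to = to} (λ {σ} {ρ} → inj σ ρ)
  where
  Fin² : ∀ {n} → Countable (Fin n × Fin n)
  Fin² = Fin-countable ×-countable Fin-countable
  to : ∀ {n k} → Swap n k → ℕ
  to (swapping a b) = code Fin² (a , b)
  inj : ∀ {n k} (σ ρ : Swap n k) → to σ ≡ to ρ → σ ≡ ρ
  inj (swapping a b) (swapping c d) eq with refl ← code-injective Fin² {a , b} {c , d} eq = refl

Action-countable : ∀ {n S k} → Countable S → Countable (Action n S k)
Action-countable {n} {S} {k} ς = mk↣ {to = code sum ∘ split} λ eq →
  split-injective _ _ (code-injective sum eq)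
  where
  Sum : Set
  Sum = Formula n S k ⊎ Fin n × Formula n S k ⊎ Swap n k
  sum : Countable Sum
  sum = Formula-countable ς ⊎-countable Fin-countable ×-countable Formula-countable ς
          ⊎-countable Swap-countable
  split : Action n S k → Sum
  split (decide φ)    = inj₁ φ
  split (witness i φ) = inj₂ (inj₁ (i , φ))
  split (turn σ)      = inj₂ (inj₂ σ)
  split-injective : ∀ α β → split α ≡ split β → α ≡ β
  split-injective (decide _)    (decide _)    refl = refl
  split-injective (witness _ _) (witness _ _) refl = refl
  split-injective (turn _)      (turn _)      refl = refl

-- For 𝖦 the transformations to be checked are generated by replacements and
-- interchanges.
unit-from-generators : ExcludedMiddle (lsuc 0ℓ) → ∀ k {M : Set} {n} (i₀ : Fin n) {V : Pred (Vec M n) 0ℓ} →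
  (∀ s → s ∈ V → ∀ i j → (s ⊙ [ i ∣ j ]) ∈ V) →
  (∀ s → s ∈ V → (σ : Swap n k) → (s ⊙ swapVec σ) ∈ V) → IsUnit k V
unit-from-generators em 𝖣 i₀ replace swapped = replace
unit-from-generators em 𝖦 i₀ replace swapped s s∈ τ =
  Units.closed em i₀ replace (λ s s∈ a b → swapped s s∈ (swapping a b)) τ s s∈

unit-replace : ∀ k {M : Set} {n} {V : Pred (Vec M n) 0ℓ} → IsUnit k V →
  ∀ s → s ∈ V → ∀ i j → (s ⊙ [ i ∣ j ]) ∈ V
unit-replace 𝖣 unit s s∈ i j = unit s s∈ i j
unit-replace 𝖦 unit s s∈ i j = unit s s∈ [ i ∣ j ]

module Omitting (em : ExcludedMiddle (lsuc 0ℓ)) {n : ℕ} (i₀ : Fin n) {S : Set} {k : Kind}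
  (ς : Countable S) (T : Pred (Formula n S k) 0ℓ) (consistent : Consistent T)
  {J : Set} (guess : Guessable J)
  (Γ : J → Pred (Formula n S k) 0ℓ) (nonprincipal : ∀ j → NonPrincipal T (Γ j))
  where

  open Choice em
  open Patterns i₀ {S} {k}
  open Conditions em i₀ {S} {k}

  Ok : Condition → Set₁
  Ok p = Tree p × (Σ (Model n S k) λ 𝔐 → 𝔐 IsModelOf T × ∃[ a ] Realizes 𝔐 a p)

  _⊑_ : Condition → Condition → Set
  q ⊑ p = ∀ {e} → e ∈ˡ p → e ∈ˡ q

  Requirement : Set
  Requirement = Vec ℕ n × Action n S k

  -- A requirement asks for its goal once its trigger occurs. The index just j stands
  -- for omitting Γ j at a tuple, nothing for the requirements of a Henkin construction.
  Trigger : Maybe J → Requirement → Condition → Set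
  Trigger nothing  (s , witness i φ) p = (s , ∃x i φ) ∈ˡ p
  Trigger _        (s , _)           p = s ∈dom p

  Goal : Maybe J → Requirement → Condition → Set
  Goal nothing  (s , decide φ)    p = (s , φ) ∈ˡ p ⊎ (s , ∼ φ) ∈ˡ p
  Goal nothing  (s , witness i φ) p = ∃[ t ] (∀ j → j ≢ i → lookup t j ≡ lookup s j) × (t , φ) ∈ˡ p
  Goal nothing  (s , turn σ)      p = (s ⊙ swapVec σ) ∈dom p
  Goal (just j) (s , _)           p = ∃[ γ ] γ ∈ Γ j × (s , ∼ γ) ∈ˡ p

  dom-mono : ∀ {s p q} → q ⊑ p → s ∈dom p → s ∈dom q
  dom-mono q⊑p (φ , s∈) = φ , q⊑p s∈

  Trigger-mono : ∀ j r {p q} → q ⊑ p → Trigger j r p → Trigger j r q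
  Trigger-mono nothing  (s , decide φ)    q⊑p = dom-mono q⊑p
  Trigger-mono nothing  (s , witness i φ) q⊑p = q⊑p
  Trigger-mono nothing  (s , turn σ)      q⊑p = dom-mono q⊑p
  Trigger-mono (just j) (s , _)           q⊑p = dom-mono q⊑p

  Goal-mono : ∀ j r {p q} → q ⊑ p → Goal j r p → Goal j r q
  Goal-mono nothing  (s , decide φ)    q⊑p (inj₁ h) = inj₁ (q⊑p h)
  Goal-mono nothing  (s , decide φ)    q⊑p (inj₂ h) = inj₂ (q⊑p h)
  Goal-mono nothing  (s , witness i φ) q⊑p (t , off , h) = t , off , q⊑p h
  Goal-mono nothing  (s , turn σ)      q⊑p = dom-mono q⊑p
  Goal-mono (just j) (s , _)           q⊑p (γ , γ∈ , h) = γ , γ∈ , q⊑p h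

  grow-ok : ∀ {p s m t φ} → Tree p → (𝔐 : Model n S k) → 𝔐 IsModelOf T → ∀ {a w} →
    Realizes 𝔐 a p → s ∈dom p → Step p s m t → Related m (map a s) w →
    w ∈ Model.V 𝔐 → Alike t w → Sat 𝔐 w φ → Ok ((t , φ) ∷ p)
  grow-ok {φ = φ} tree 𝔐 ⊨T real s∈ step related w∈ alike h
    with realizes-grow 𝔐 s∈ step real related w∈ alike h
  ... | a′ , real′ , _ = grow φ tree s∈ step , 𝔐 , ⊨T , a′ , real′

  assert-ok : ∀ {p s φ} → Tree p → (𝔐 : Model n S k) → 𝔐 IsModelOf T → ∀ {a} →
    Realizes 𝔐 a p → s ∈dom p → Sat 𝔐 (map a s) φ → Ok ((s , φ) ∷ p)
  assert-ok {s = s} tree 𝔐 ⊨T real s∈ h with real s (proj₁ s∈) (proj₂ s∈)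
  ... | w∈ , alike , _ = grow-ok tree 𝔐 ⊨T real s∈ again refl w∈ alike h

  lookup≤sum : ∀ {m} (s : Vec ℕ m) i → lookup s i ≤ Vec.sum s
  lookup≤sum (x ∷ s) zero    = m≤m+n x _
  lookup≤sum (x ∷ s) (suc i) = ≤-trans (lookup≤sum s i) (m≤n+m _ x)

  height : Condition → ℕ
  height []            = 0
  height ((s , _) ∷ p) = Vec.sum s + height p

  sum≤height : ∀ {s φ p} → (s , φ) ∈ˡ p → Vec.sum s ≤ height p
  sum≤height (here refl)               = m≤m+n _ _
  sum≤height {p = (t , _) ∷ p} (there m) = ≤-trans (sum≤height m) (m≤n+m _ (Vec.sum t))

  new-constant : ∀ p → ¬ Constant p (suc (height p))
  new-constant p (s , (φ , s∈) , i , eq) =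
    <⇒≱ (n<1+n (height p))
      (subst (_≤ height p) eq (≤-trans (lookup≤sum s i) (sum≤height s∈)))

  -- The last case is the use of nonprincipality. If no negation of an element of Γ j
  -- can be added at s, then the formula describing the condition at s
  -- implies all of Γ j; it is consistent with T since the condition is realized.
  -- In the case of a witness, the coordinate i of a witness in the model
  -- either repeats another coordinate, and the constant is copied, or is
  -- new to the tuple, and a fresh constant names it, even if an element named
  -- elsewhere reappears.
  meet : ∀ j r q → Ok q → Trigger j r q → Σ Condition λ q′ → q′ ⊑ q × Ok q′ × Goal j r q′
  meet nothing (s , decide φ) q (tree , 𝔐 , ⊨T , a , real) s∈ with dec (Sat 𝔐 (map a s) φ)
  ... | yes h = (s , φ) ∷ q , there , assert-ok tree 𝔐 ⊨T real s∈ h , inj₁ (here refl)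
  ... | no ¬h = (s , ∼ φ) ∷ q , there , assert-ok tree 𝔐 ⊨T real s∈ ¬h , inj₂ (here refl)
  meet nothing (s , turn σ) q (tree , 𝔐 , ⊨T , a , real) s∈ with real s (proj₁ s∈) (proj₂ s∈)
  ... | w∈ , alike , _ = (s ⊙ swapVec σ , ⊤ᶠ) ∷ q , there ,
    grow-ok tree 𝔐 ⊨T real s∈ (turn σ) refl (swap-∈V 𝔐 σ w∈)
      (Alike-⊙ s (map a s) (swapVec σ) alike) refl ,
    (⊤ᶠ , here refl)
  meet nothing (s , witness i φ) q (tree , 𝔐 , ⊨T , a , real) m with real s (∃x i φ) m
  ... | s∈V , alike , w , w∈ , off , h with dec (∃[ j ] j ≢ i × lookup w i ≡ lookup w j)
  ... | yes (j , j≢i , same) = (t , φ) ∷ q , there ,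
    grow-ok tree 𝔐 ⊨T real (_ , m) (copy i j j≢i) off w∈ alike′ h , (t , off′ , here refl)
    where
    t : Vec ℕ n
    t = s ⊙ [ i ∣ j ]
    off′ : ∀ l → l ≢ i → lookup t l ≡ lookup s l
    off′ l l≢i = trans (lookup-⊙ s [ i ∣ j ] l) (cong (lookup s) (lookup-replace-other j l≢i))
    w≡ : map a s ⊙ [ i ∣ j ] ≡ w
    w≡ = lookup-extensional at
      where
      at : ∀ l → lookup (map a s ⊙ [ i ∣ j ]) l ≡ lookup w l
      at l with l ≟ᶠ i
      ... | yes refl = trans (lookup-⊙ (map a s) [ i ∣ j ] i)
        (trans (cong (lookup (map a s)) (lookup-replace i j)) (trans (sym (off j j≢i)) (sym same)))
      ... | no l≢i   = trans (lookup-⊙ (map a s) [ i ∣ j ] l)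
        (trans (cong (lookup (map a s)) (lookup-replace-other j l≢i)) (sym (off l l≢i)))
    alike′ : Alike t w
    alike′ = subst (Alike t) w≡ (Alike-⊙ s (map a s) [ i ∣ j ] alike)
  ... | no distinct = (t , φ) ∷ q , there ,
    grow-ok tree 𝔐 ⊨T real (_ , m) (fresh i c new) off w∈ alike′ h ,
    (t , (λ l l≢i → lookup∘update′ l≢i s c) , here refl)
    where
    c : ℕ
    c = suc (height q)
    new : ¬ Constant q c
    new = new-constant q
    t : Vec ℕ n
    t = s [ i ]≔ c
    t-off : ∀ {l} → l ≢ i → lookup t l ≡ lookup s l
    t-off l≢i = lookup∘update′ l≢i s c
    c-new : ∀ {l} → l ≢ i → lookup t i ≢ lookup t l
    c-new {l} l≢i eq = new (s , (_ , m) , l ,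
      trans (sym (t-off l≢i)) (trans (sym eq) (lookup∘update i s c)))
    alike′ : Alike t w
    alike′ j l with j ≟ᶠ i | l ≟ᶠ i
    ... | yes refl | yes refl = (λ _ → refl) , λ _ → refl
    ... | yes refl | no l≢i   =
      (λ eq → contradiction eq (c-new l≢i)) , λ eq → contradiction (l , l≢i , eq) distinct
    ... | no j≢i   | yes refl =
      (λ eq → contradiction (sym eq) (c-new j≢i)) , λ eq → contradiction (j , j≢i , sym eq) distinct
    ... | no j≢i   | no l≢i   =
      (λ eq → trans (off j j≢i) (trans (proj₁ (alike j l)
         (trans (sym (t-off j≢i)) (trans eq (t-off l≢i)))) (sym (off l l≢i)))) ,
      (λ eq → trans (t-off j≢i) (trans (proj₂ (alike j l)
         (trans (sym (off j j≢i)) (trans eq (off l l≢i)))) (sym (t-off l≢i))))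
  meet (just j) (s , _) q (tree , 𝔐 , ⊨T , a , real) s∈
    with em {Σ (Formula n S k) λ γ → γ ∈ Γ j × Ok ((s , ∼ γ) ∷ q)}
  ... | yes (γ , γ∈ , ok) = (s , ∼ γ) ∷ q , there , ok , (γ , γ∈ , here refl)
  ... | no none = contradiction (Ψ , possible , implies) (nonprincipal j)
    where
    description : ∃[ Ψ ] Describes Ψ q (λ _ → ⊤ᶠ) s
    description = describe tree (λ _ → ⊤ᶠ) s s∈
    Ψ : Formula n S k
    Ψ = proj₁ description
    s∈V : map a s ∈ Model.V 𝔐
    s∈V = proj₁ (real s (proj₁ s∈) (proj₂ s∈))
    possible : Ψ ConsistentWith T
    possible never = never 𝔐 ⊨T (map a s) s∈V
      (proj₂ (proj₂ description 𝔐 (map a s) s∈V) (a , refl , real , λ _ _ → refl))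
    implies : ∀ γ → γ ∈ Γ j → T ⊨ (Ψ ⇒ γ)
    implies γ γ∈ 𝔑 ⊨T′ w w∈ (hΨ , ¬γ) with proj₁ (proj₂ description 𝔑 w w∈) hΨ
    ... | a′ , refl , real′ , _ = none (γ , γ∈ , assert-ok tree 𝔑 ⊨T′ real′ s∈ ¬γ)

  Settled : Maybe J → Requirement → Condition → Set₁
  Settled j r p = Goal j r p ⊎ (∀ q → q ⊑ p → Ok q → ¬ Trigger j r q)

  settled-open : ∀ j r {p q} → q ⊑ p → Settled j r p → Settled j r q
  settled-open j r q⊑p (inj₁ goal)  = inj₁ (Goal-mono j r q⊑p goal)
  settled-open j r q⊑p (inj₂ never) = inj₂ λ q′ q′⊑q → never q′ (q′⊑q ∘ q⊑p)

  -- Being settled is made open by counting a requirement as settled if no extension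
  -- triggers it.
  settled-dense : ∀ j r p → Ok p → Σ Condition λ q → q ⊑ p × Ok q × Settled j r q
  settled-dense j r p ok with em {Σ Condition λ q → q ⊑ p × Ok q × Trigger j r q}
  ... | no none = p , id , ok , inj₂ λ q q⊑p okq trigger → none (q , q⊑p , okq , trigger)
  ... | yes (q , q⊑p , okq , trigger) with meet j r q okq trigger
  ... | q′ , q′⊑q , ok′ , goal = q′ , (λ m → q′⊑q (q⊑p m)) , ok′ , inj₁ goal

  -- One tuple of the unit of a model of T, with constants that repeat as its entries do.
  initial : Consistent T → Σ Condition Ok
  initial (𝔐 , ⊨T) with Model.covered 𝔐 (Model.nonempty 𝔐)
  ... | w , w∈ , _ = (s , ⊤ᶠ) ∷ [] , root s ⊤ᶠ , 𝔐 , ⊨T , a , real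
    where
    name : Model.Base 𝔐 → ℕ
    name b = toℕ (preimage (lookup w) i₀ b)
    s : Vec ℕ n
    s = map name w
    alike : Alike s w
    alike i j =
      (λ eq → trans (sym (preimage-correct (lookup w) i₀ i))
        (trans (cong (lookup w) (toℕ-injective
           (trans (sym (lookup-map i name w)) (trans eq (lookup-map j name w)))))
          (preimage-correct (lookup w) i₀ j))) ,
      (λ eq → trans (lookup-map i name w) (trans (cong name eq) (sym (lookup-map j name w))))
    tuple : Σ (ℕ → Model.Base 𝔐) λ a → map a s ≡ w
    tuple = realize-tuple (Model.nonempty 𝔐) s w alike
    a : ℕ → Model.Base 𝔐
    a = proj₁ tuple
    real : Realizes 𝔐 a ((s , ⊤ᶠ) ∷ [])
    real _ _ (here refl) =
      subst (λ v → v ∈ Model.V 𝔐 × Alike s v × Sat 𝔐 v ⊤ᶠ) (sym (proj₂ tuple)) (w∈ , alike , refl)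

  start : Σ Condition Ok
  start = initial consistent

  opaque
    chain : Σ (ℕ → Condition) λ x →
      (∀ t → Ok (x t)) × (∀ t → x (suc t) ⊑ x t) ×
      (∀ j r → ∃[ t ] Settled j r (x t))
    chain = Generic.generic em (Maybe-guessable guess)
      (List-countable (Vec-countable ℕ-countable ×-countable Formula-countable ς))
      (Vec-countable ℕ-countable ×-countable Action-countable ς)
      _⊑_ (λ _ → id) (λ p⊑q q⊑r m → p⊑q (q⊑r m)) Ok Settled settled-open settled-dense
      (proj₁ start) (proj₂ start)

  x : ℕ → Condition
  x = proj₁ chain

  x-ok : ∀ t → Ok (x t)
  x-ok = proj₁ (proj₂ chain)

  x-descending : ∀ {t u} → t ≤ u → x u ⊑ x t
  x-descending {t} {zero} z≤n = id
  x-descending {t} {suc u} t≤ with m≤n⇒m<n∨m≡n t≤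
  ... | inj₁ (s≤s t≤u) = proj₁ (proj₂ (proj₂ chain)) u ∘ x-descending t≤u
  ... | inj₂ refl        = id

  achieved : ∀ j r {t} → Trigger j r (x t) → ∃[ u ] Goal j r (x u)
  achieved j r {t} trigger with proj₂ (proj₂ (proj₂ chain)) j r
  ... | u , inj₁ goal  = u , goal
  ... | u , inj₂ never = contradiction
    (Trigger-mono j r (x-descending (m≤m⊔n t u)) trigger)
    (never (x (t ⊔ u)) (x-descending (m≤n⊔m t u)) (x-ok (t ⊔ u)))

  -- Assertion at some stage of the chain; this is truth in the model to be built.
  _⊩_ : Vec ℕ n → Formula n S k → Set
  s ⊩ φ = ∃[ t ] (s , φ) ∈ˡ x t

  Tuple : Vec ℕ n → Set
  Tuple s = ∃[ φ ] s ⊩ φ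

  -- Finitely many assertions occur at a common stage, which is realized.
  together : ∀ {s φ s′ φ′ s″ φ″} → s ⊩ φ → s′ ⊩ φ′ → s″ ⊩ φ″ →
    Σ (Model n S k) λ 𝔐 → 𝔐 IsModelOf T × ∃[ a ]
      RealizesAt 𝔐 a s φ × RealizesAt 𝔐 a s′ φ′ × RealizesAt 𝔐 a s″ φ″
  together (t , m) (t′ , m′) (t″ , m″) with x-ok (t ⊔ (t′ ⊔ t″))
  ... | _ , 𝔐 , ⊨T , a , real = 𝔐 , ⊨T , a ,
    real _ _ (x-descending (m≤m⊔n t _) m) ,
    real _ _ (x-descending (≤-trans (m≤m⊔n t′ t″) (m≤n⊔m t _)) m′) ,
    real _ _ (x-descending (≤-trans (m≤n⊔m t′ t″) (m≤n⊔m t _)) m″)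

  decided : ∀ {s} → Tuple s → ∀ φ → s ⊩ φ ⊎ s ⊩ (∼ φ)
  decided {s} (ψ , t , m) φ with achieved nothing (s , decide φ) {t} (ψ , m)
  ... | u , inj₁ h = inj₁ (u , h)
  ... | u , inj₂ h = inj₂ (u , h)

  -- The negation of φ cannot be asserted if the other assertions exclude it, and
  -- one of the two is asserted.
  forced : ∀ {s s′ ψ s″ θ} → Tuple s → s′ ⊩ ψ → s″ ⊩ θ → ∀ φ →
    (∀ 𝔐 → 𝔐 IsModelOf T → ∀ a → map a s ∈ Model.V 𝔐 → Alike s (map a s) →
      RealizesAt 𝔐 a s′ ψ → RealizesAt 𝔐 a s″ θ → Sat 𝔐 (map a s) φ) → s ⊩ φ
  forced s∈ h h′ φ always with decided s∈ φ
  ... | inj₁ holds = holds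
  ... | inj₂ fails with together fails h h′
  ... | 𝔐 , ⊨T , a , (w∈ , alike , ¬φ) , r , r′ =
    contradiction (always 𝔐 ⊨T a w∈ alike r r′) ¬φ

  witnesses : ∀ {s i φ} → s ⊩ ∃x i φ → ∃[ t ] (∀ j → j ≢ i → lookup t j ≡ lookup s j) × t ⊩ φ
  witnesses {s} {i} {φ} (t , m) with achieved nothing (s , witness i φ) {t} m
  ... | u , s′ , off , m′ = s′ , off , u , m′

  Tuple-swap : ∀ s → Tuple s → (σ : Swap n k) → Tuple (s ⊙ swapVec σ)
  Tuple-swap s (ψ , t , m) σ with achieved nothing (s , turn σ) {t} (ψ , m)
  ... | u , φ , m′ = φ , u , m′

  -- s ∘ [i|j] is the witness of the formula ∃xᵢ (xᵢ = xⱼ).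
  Tuple-replace : ∀ s → Tuple s → ∀ i j → Tuple (s ⊙ [ i ∣ j ])
  Tuple-replace s s∈@(ψ , h) i j with j ≟ᶠ i
  ... | yes refl = subst Tuple (sym (lookup-extensional same)) s∈
    where
    same : ∀ l → lookup (s ⊙ [ i ∣ i ]) l ≡ lookup s l
    same l with l ≟ᶠ i
    ... | yes refl = trans (lookup-⊙ s [ i ∣ i ] i) (cong (lookup s) (lookup-replace i i))
    ... | no l≢i   = trans (lookup-⊙ s [ i ∣ i ] l) (cong (lookup s) (lookup-replace-other i l≢i))
  ... | no j≢i = result (witnesses (forced s∈ h h (∃x i (i ≐ j)) always))
    where
    at-i : ∀ {M : Set} (w : Vec M n) → lookup (w ⊙ [ i ∣ j ]) i ≡ lookup w j
    at-i w = trans (lookup-⊙ w [ i ∣ j ] i) (cong (lookup w) (lookup-replace i j))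
    at-other : ∀ {M : Set} (w : Vec M n) l → l ≢ i → lookup (w ⊙ [ i ∣ j ]) l ≡ lookup w l
    at-other w l l≢i = trans (lookup-⊙ w [ i ∣ j ] l) (cong (lookup w) (lookup-replace-other j l≢i))
    always : ∀ 𝔐 → 𝔐 IsModelOf T → ∀ a → map a s ∈ Model.V 𝔐 → Alike s (map a s) →
      RealizesAt 𝔐 a s ψ → RealizesAt 𝔐 a s ψ → Sat 𝔐 (map a s) (∃x i (i ≐ j))
    always 𝔐 _ a w∈ _ _ _ = map a s ⊙ [ i ∣ j ] ,
      unit-replace k (Model.isUnit 𝔐) (map a s) w∈ i j , at-other (map a s) ,
      trans (at-i (map a s)) (sym (at-other (map a s) j j≢i))
    result : ∃[ t ] (∀ l → l ≢ i → lookup t l ≡ lookup s l) × t ⊩ (i ≐ j) → Tuple (s ⊙ [ i ∣ j ])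
    result (t , off , h′) = subst Tuple (lookup-extensional at) (_ , h′)
      where
      same : lookup t i ≡ lookup t j
      same with together h′ h′ h′
      ... | _ , _ , _ , (_ , alike , eq) , _ = proj₂ (alike i j) eq
      at : ∀ l → lookup t l ≡ lookup (s ⊙ [ i ∣ j ]) l
      at l with l ≟ᶠ i
      ... | yes refl = trans same (trans (off j j≢i) (sym (at-i s)))
      ... | no l≢i   = trans (off l l≢i) (sym (at-other s l l≢i))

  Used : ℕ → Set
  Used c = ∃[ s ] Tuple s × (∃[ i ] lookup s i ≡ c)

  used : ℕ → Bool
  used c = does (dec (Used c))

  -- Only constants that occur in a tuple; a Boolean condition, so that equality of
  -- elements is equality of constants.
  Base : Set
  Base = Σ ℕ λ c → used c ≡ true

  Base-≡ : {b b′ : Base} → proj₁ b ≡ proj₁ b′ → b ≡ b′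
  Base-≡ {c , u} {c , u′} refl = cong (c ,_) (uip u u′)
    where
    uip : ∀ {x : Bool} (p q : x ≡ true) → p ≡ q
    uip refl refl = refl

  Base-countable : Countable Base
  Base-countable = mk↣ {to = proj₁} Base-≡

  Base-used : (b : Base) → Used (proj₁ b)
  Base-used (c , u) = extract (dec (Used c)) u
    where
    extract : ∀ {A : Set} (d : Dec A) → does d ≡ true → A
    extract (yes a) _ = a

  names : Vec Base n → Vec ℕ n
  names = map proj₁

  inBase : ∀ s → Tuple s → Vec Base n
  inBase s s∈ = tabulate λ i →
    lookup s i , dec-true (dec (Used (lookup s i))) (s , s∈ , i , refl)

  lookup-inBase : ∀ s s∈ i → proj₁ (lookup (inBase s s∈) i) ≡ lookup s i
  lookup-inBase s s∈ i = cong proj₁ (lookup∘tabulate _ i)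

  names-inBase : ∀ s s∈ → names (inBase s s∈) ≡ s
  names-inBase s s∈ = lookup-extensional λ i →
    trans (lookup-map i proj₁ (inBase s s∈)) (lookup-inBase s s∈ i)

  some-tuple : Σ (Vec ℕ n) Tuple
  some-tuple = from-tree (proj₁ (x-ok 0)) id
    where
    from-tree : ∀ {p} → Tree p → x 0 ⊑ p → Σ (Vec ℕ n) Tuple
    from-tree (root s φ)       below = s , φ , 0 , below (here refl)
    from-tree (grow φ _ _ _) below = _ , φ , 0 , below (here refl)

  𝔊 : Model n S k
  𝔊 = record
    { Base     = Base
    ; nonempty = lookup (inBase (proj₁ some-tuple) (proj₂ some-tuple)) i₀
    ; V        = V
    ; isUnit   = unit-from-generators em k i₀ {V}
        (λ s s∈ i j → subst Tuple (sym (map-⊙ proj₁ s [ i ∣ j ])) (Tuple-replace (names s) s∈ i j))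
        (λ s s∈ σ → subst Tuple (sym (map-⊙ proj₁ s (swapVec σ))) (Tuple-swap (names s) s∈ σ))
    ; covered  = covered
    ; ⟦_⟧      = λ R s → names s ⊩ rel R
    ; ⟦⟧⊆V     = λ R h → rel R , h
    }
    where
    V : Pred (Vec Base n) 0ℓ
    V s = Tuple (names s)
    covered : ∀ b → ∃[ s ] s ∈ V × (∃[ i ] lookup s i ≡ b)
    covered b with Base-used b
    ... | s , s∈ , i , eq = inBase s s∈ , subst Tuple (sym (names-inBase s s∈)) s∈ , i ,
      Base-≡ (trans (lookup-inBase s s∈ i) eq)

  -- Truth in the generic model is assertion. For an existential formula at s the chain has
  -- supplied a witness; conversely any tuple of the unit agreeing with s off i was
  -- realized jointly with s in a model of T, where it witnesses the formula.
  forced⇒true : ∀ φ s → names s ⊩ φ → Sat 𝔊 s φ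
  true⇒forced : ∀ φ s → s ∈ Model.V 𝔊 → Sat 𝔊 s φ → names s ⊩ φ

  forced⇒true (rel R) s h = h
  forced⇒true (relₛ R τ) s h =
    forced (Model.isUnit 𝔊 s (_ , h) τ) h h (rel R)
      λ 𝔐 _ a _ _ (_ , _ , holds) _ →
        subst (Model.⟦_⟧ 𝔐 R) (trans (sym (map-⊙ a (names s) τ)) (cong (map a) (sym (map-⊙ proj₁ s τ)))) holds
  forced⇒true (i ≐ j) s h with together h h h
  ... | _ , _ , _ , (_ , alike , eq) , _ = Base-≡
    (trans (sym (lookup-map i proj₁ s)) (trans (proj₂ (alike i j) eq) (lookup-map j proj₁ s)))
  forced⇒true (∼ φ) s h true-φ with true⇒forced φ s (_ , h) true-φ
  ... | h′ with together h h′ h′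
  ... | _ , _ , _ , (_ , _ , ¬φ) , (_ , _ , φ-holds) , _ = ¬φ φ-holds
  forced⇒true (φ ∧ ψ) s h =
    forced⇒true φ s (forced (_ , h) h h φ λ { _ _ _ _ _ (_ , _ , both) _ → proj₁ both }) ,
    forced⇒true ψ s (forced (_ , h) h h ψ λ { _ _ _ _ _ (_ , _ , both) _ → proj₂ both })
  forced⇒true (∃x i φ) s h with witnesses h
  ... | t , off , h′ = t̂ , subst Tuple (sym names-t̂) (_ , h′) ,
    (λ j j≢i → Base-≡ (trans (lookup-inBase t (_ , h′) j)
      (trans (off j j≢i) (lookup-map j proj₁ s)))) ,
    forced⇒true φ t̂ (subst (_⊩ φ) (sym names-t̂) h′)
    where
    t̂ : Vec Base n
    t̂ = inBase t (_ , h′)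
    names-t̂ : names t̂ ≡ t
    names-t̂ = names-inBase t (_ , h′)

  true⇒forced (rel R) s s∈ h = h
  true⇒forced (relₛ R τ) s s∈ h = forced s∈ h h (relₛ R τ)
    λ 𝔐 _ a _ _ (_ , _ , holds) _ →
      subst (Model.⟦_⟧ 𝔐 R) (trans (cong (map a) (map-⊙ proj₁ s τ)) (map-⊙ a (names s) τ)) holds
  true⇒forced (i ≐ j) s s∈@(_ , h) eq = forced s∈ h h (i ≐ j)
    λ _ _ _ _ alike _ _ → proj₁ (alike i j)
      (trans (lookup-map i proj₁ s) (trans (cong proj₁ eq) (sym (lookup-map j proj₁ s))))
  true⇒forced (∼ φ) s s∈ ¬φ with decided s∈ φ
  ... | inj₁ h = contradiction (forced⇒true φ s h) ¬φ
  ... | inj₂ h = h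
  true⇒forced (φ ∧ ψ) s s∈ (h , h′) =
    forced s∈ (true⇒forced φ s s∈ h) (true⇒forced ψ s s∈ h′) (φ ∧ ψ)
      λ { _ _ _ _ _ (_ , _ , r) (_ , _ , r′) → r , r′ }
  true⇒forced (∃x i φ) s s∈ (t , t∈ , off , h) = forced s∈ h′ h′ (∃x i φ)
    λ { 𝔐 _ a _ _ (w∈ , _ , holds) _ → map a (names t) , w∈ ,
        (λ j j≢i → trans (lookup-map j a (names t)) (trans (cong a (names-off j j≢i))
          (sym (lookup-map j a (names s))))) , holds }
    where
    h′ : names t ⊩ φ
    h′ = true⇒forced φ t t∈ h
    names-off : ∀ j → j ≢ i → lookup (names t) j ≡ lookup (names s) j
    names-off j j≢i = trans (lookup-map j proj₁ t)
      (trans (cong proj₁ (off j j≢i)) (sym (lookup-map j proj₁ s)))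

  𝔊-models : 𝔊 IsModelOf T
  𝔊-models φ φ∈ s s∈@(_ , h) = forced⇒true φ s
    (forced s∈ h h φ λ 𝔐 ⊨T a w∈ _ _ _ → ⊨T φ φ∈ (map a (names s)) w∈)

  𝔊-omits : ∀ j → 𝔊 Omits Γ j
  𝔊-omits j (s , (ψ , t , m) , all) with achieved (just j) (names s , decide ⊤ᶠ) {t} (ψ , m)
  ... | u , γ , γ∈ , m′ = forced⇒true (∼ γ) s (u , m′) (all γ γ∈)

-- Countable families and families smaller than cov K are both guessable, and are
-- treated alike from there on.
omitting : ExcludedMiddle (lsuc 0ℓ) → ∀ {n} → Fin n → ∀ {S k} → Countable S →
  (T : Pred (Formula n S k) 0ℓ) → Consistent T →
  ∀ {I} → Guessable I →
  (Γ : I → Pred (Formula n S k) 0ℓ) → (∀ i → NonPrincipal T (Γ i)) →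
  ∃[ 𝔐 ] 𝔐 IsModelOf T × Countable (Model.Base 𝔐) × (∀ i → 𝔐 Omits Γ i)
omitting em i₀ ς T consistent guess Γ nonprincipal =
  𝔊 , 𝔊-models , Base-countable , 𝔊-omits
  where open Omitting em i₀ ς T consistent guess Γ nonprincipal

theorem5p33 : ExcludedMiddle (lsuc 0ℓ) →
    (n : ℕ) → 1 < n → (k : Kind) →
    OmittingTypesTheorem n k ×
    ((κ : Set) → IsCovK κ →
    (S : Set) → Countable S →
    (T : Pred (Formula n S k) 0ℓ) → Consistent T →
    (I : Set) → I ≺ κ →
    (Γ : I → Pred (Formula n S k) 0ℓ) → (∀ i → NonPrincipal T (Γ i)) →
    ∃[ 𝔐 ] 𝔐 IsModelOf T × Countable (Model.Base 𝔐) × (∀ i → 𝔐 Omits Γ i))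
theorem5p33 em n 1<n k =
  (λ S ς T consistent I ι Γ nonprincipal →
    let (𝔐 , models , _ , omits) =
          omitting em (fromℕ< 1<n) ς T consistent (Countable⇒Guessable ι) Γ nonprincipal
    in 𝔐 , models , omits) ,
  (λ κ cov S ς T consistent I I≺κ Γ nonprincipal →
    omitting em (fromℕ< 1<n) ς T consistent (≺-covK⇒Guessable cov I≺κ) Γ nonprincipal)
  where
  open Choice em using (Countable⇒Guessable)
  open Line em using (≺-covK⇒Guessable)
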